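{- Let $P$ be a non-speculative program with input selectability and $P'$ a simply typed program corresponding to $P$. Let $Q$ be a permutation simply typed query and $Q'$ a simply typed query corresponding to $Q$. If there is an infinite delay-respecting derivation of $P\cup\{Q\}$, then there is an infinite LD-derivation of $P'\cup\{Q'\}$.
   Context: Basics. A query is a finite sequence of atoms; a clause is $h\leftarrow B$ with $h$ an atom and $B$ a query. Every predicate has a fixed mode, i.e. each argument position is either input or output; $p(\mathbf s,\mathbf t)$ denotes an atom with $\mathbf s$ (resp. $\mathbf t$) the vector of terms filling the input (resp. output) positions. In clause heads $p(\mathbf t_0,\mathbf s_{n+1})$, $\mathbf t_0$ is the input and $\mathbf s_{n+1}$ the output. A syntactic object is linear if each variable occurs in it at most once. A clause is input-linear if the vector of input terms of its head is linear; a program is input-linear if all its clauses are and it does not use the equality predicate $=$ with both arguments input. A flat term is a variable or a term $f(x_1,\dots,x_n)$, $n\ge 0$, with distinct variables $x_i$. A permutation $\pi$ on $\{1,\dots,n\}$ is extended by $\pi(i)=i$ outside $\{1,\dots,n\}$, and $\pi(o_1,\dots,o_n)=o_{\pi^{ -1}(1)},\dots,o_{\pi^{ -1}(n)}$. Types. A type is a set of terms closed under instantiation. The variable type is the type of all terms; any other type is a non-variable type. Each argument position of each predicate has an associated type. $t:T$ means $t\in T$ (componentwise for vectors); $\models \varphi\Rightarrow \mathbf t:\mathbf T$ means that the implication holds after applying any substitution to all terms. A term is type-consistent (in a position of type $T$) if some instance of it is in $T$. Nicely moded. $Q=p_1(\mathbf s_1,\mathbf t_1),\dots,p_n(\mathbf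 s_n,\mathbf t_n)$ is $\pi$-nicely moded if $\mathbf t_1,\dots,\mathbf t_n$ is linear and for all $i$, $vars(\mathbf s_i)\cap\bigcup_{\pi(i)\le\pi(j)\le n}vars(\mathbf t_j)=\emptyset$. A clause $p(\mathbf t_0,\mathbf s_{n+1})\leftarrow Q$ is $\pi$-nicely moded if $Q$ is and $vars(\mathbf t_0)\cap\bigcup_{j=1}^n vars(\mathbf t_j)=\emptyset$. Well typed. With $p_i(\mathbf S_i,\mathbf T_i)$ the type of $p_i$, $Q$ is $\pi$-well typed if for all $i\in\{1,\dots,n\}$, $\models(\bigwedge_{1\le\pi(j)<\pi(i)}\mathbf t_j:\mathbf T_j)\Rightarrow\mathbf s_i:\mathbf S_i$. A clause $p(\mathbf t_0,\mathbf s_{n+1})\leftarrow Q$, with $p(\mathbf T_0,\mathbf S_{n+1})$ the type of $p$, is $\pi$-well typed if for all $i\in\{1,\dots,n+1\}$, $\models(\bigwedge_{0\le\pi(j)<\pi(i)}\mathbf t_j:\mathbf T_j)\Rightarrow\mathbf s_i:\mathbf S_i$. Simply typed. $Q$ is $\pi$-simply typed if it is $\pi$-nicely moded and $\pi$-well typed and $\mathbf t_1,\dots,\mathbf t_n$ is a vector of variables. A clause $p(\mathbf t_0,\mathbf s_{n+1})\leftarrow Q$ is $\pi$-simply typed if it is $\pi$-nicely moded and $\pi$-well typed, $\mathbf t_1,\dots,\mathbf t_n$ is a vector of variables, and $\mathbf t_0$ is a vector of flat type-consistent terms that has a variable in each position of variable type. "Permutation simply typed" means $\pi$-simply typed for some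 $\pi$ (for each clause, for programs); "simply typed" means this with $\pi$ the identity. A simply typed query (clause) corresponding to a $\pi$-simply typed query $Q$ (clause $h\leftarrow B$) is $\pi(Q)$ (resp. $h\leftarrow\pi(B)$); a simply typed program corresponding to $P$ is obtained by replacing every clause by a simply typed clause corresponding to it. Bound/free. An input position of a predicate $p$ is bound (in $P$) if some clause head $p(\dots)$ in $P$ has a non-variable term there; an output position is bound if some body atom $p(\dots)$ in $P$ has a non-variable term there; otherwise it is free. (In a permutation simply typed program all output positions are free.) Derivations. A program consists of clauses and, for each predicate $p/n$, a block declaration: a (possibly empty) set of atoms $p(b_1,\dots,b_n)$ with $b_i\in\{?,-\}$. An atom $p(t_1,\dots,t_n)$ is blocked if for some $p(b_1,\dots,b_n)$ in the declaration, $t_i$ is a variable for all $i$ with $b_i=-$; otherwise it is selectable. In a derivation step a query $Q_1,a,Q_2$ is replaced by $(Q_1,B,Q_2)\theta$, where $h\leftarrow B$ is a variant, renamed apart, of a program clause and $\theta$ is a most general unifier of the selected atom $a$ and $h$. A derivation of $P\cup\{Q\}$ is a (finite or infinite) sequence of such steps starting at $Q$. An LD-derivation always selects the leftmost atom (ignoring block declarations). A delay-respecting derivation always selects a selectable atom. Input selectability. A permutation simply typed program $P$ has input selectability if every atom (using a predicate of $P$) that has variables in all free output positions is selectable in $P$ (1) only if it is non-variable in all bound input positions, and (2) if it is non-variable in all input positions of non-variable type. Non-speculative. A program $P$ is non-speculative if it is permutation simply typed and input-linear, and every simply typed atom (i.e. one-atom query) using a predicate in $P$ is unifiable with some (renamed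 apart) clause head in $P$.
   Formalization: The query Q is additionally assumed to use only predicates occurring in P; otherwise the claim fails, e.g. P = {p ← p} and Q = q, p with q not in P, where p can be selected forever but the LD-derivation is stuck at q. -}

module Defs where

open import Data.Fin using (Fin; _≤_; _<_)
open import Data.Fin.Permutation using (Permutation′; _⟨$⟩ʳ_; _⟨$⟩ˡ_; id)
open import Data.List using (List; []; _∷_; _++_; map; concatMap; length; lookup; tabulate)
open import Data.List.Membership.Propositional using (_∈_)
open import Data.List.Relation.Binary.Disjoint.Propositional using (Disjoint)
open import Data.List.Relation.Binary.Pointwise using (Pointwise)
open import Data.List.Relation.Unary.All using (All)
open import Data.List.Relation.Unary.Any using (Any)
open import Data.List.Relation.Unary.Unique.Propositional using (Unique)
open import Data.Nat using (ℕ; suc; _+_)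
import Data.Nat as ℕ
open import Data.Product using (_×_; ∃-syntax; Σ-syntax)
open import Data.Sum using (_⊎_; inj₁; inj₂)
open import Data.Vec using (Vec; []; _∷_)
import Data.Vec as Vec
import Data.Vec.Relation.Unary.All as VecAll
import Data.Vec.Relation.Unary.Unique.Propositional as VecUnique
open import Relation.Binary.PropositionalEquality using (_≡_; _≢_)
open import Relation.Nullary using (¬_)

Var : Set
Var = ℕ

module Terms (Fun : Set) (arity : Fun → ℕ) where

  data Term : Set where
    var : Var → Term
    fun : (f : Fun) → Vec Term (arity f) → Term

  Subst : Set
  Subst = Var → Term

  mutual
    _[_] : Term → Subst → Term
    var x    [ σ ] = σ x
    fun f ts [ σ ] = fun f (ts [ σ ]ᵛ)

    _[_]ᵛ : ∀ {n} → Vec Term n → Subst → Vec Term n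
    []       [ σ ]ᵛ = []
    (t ∷ ts) [ σ ]ᵛ = (t [ σ ]) ∷ (ts [ σ ]ᵛ)

  -- Variable occurrences, with repetitions.
  mutual
    vars : Term → List Var
    vars (var x)    = x ∷ []
    vars (fun f ts) = varsᵛ ts

    varsᵛ : ∀ {n} → Vec Term n → List Var
    varsᵛ []       = []
    varsᵛ (t ∷ ts) = vars t ++ varsᵛ ts

  data IsVar : Term → Set where
    isVar : ∀ x → IsVar (var x)

  data Flat : Term → Set where
    flat-var : ∀ x → Flat (var x)
    flat-fun : ∀ f (xs : Vec Var (arity f)) → VecUnique.Unique xs →
               Flat (fun f (Vec.map var xs))

  record Type : Set₁ where
    field
      Member : Term → Set
      closed : ∀ t σ → Member t → Member (t [ σ ])

  _∶_ : Term → Type → Set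
  t ∶ T = Type.Member T t

  _∶ᵛ_ : ∀ {n} → Vec Term n → (Fin n → Type) → Set
  ts ∶ᵛ Ts = ∀ i → Vec.lookup ts i ∶ Ts i

  IsVariableType : Type → Set
  IsVariableType T = ∀ t → t ∶ T

  TypeConsistent : Term → Type → Set
  TypeConsistent t T = ∃[ σ ] ((t [ σ ]) ∶ T)

-- The argument positions of a predicate are listed with the input positions
-- first, following the notation p(s,t).
record Signature : Set₁ where
  field
    Fun   : Set
    arity : Fun → ℕ

  open Terms Fun arity public

  field
    Pred       : Set
    inArity    : Pred → ℕ
    outArity   : Pred → ℕ
    inType     : (p : Pred) → Fin (inArity p) → Type
    outType    : (p : Pred) → Fin (outArity p) → Type
    -- The predicate symbols that stand for "=".  Several are allowed because a
    -- symbol has one mode only.  They are resolved by the clauses of the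
    -- program (such as x = x ←), like any other predicate.
    IsEquality : Pred → Set
    equality-binary : ∀ p → IsEquality p → inArity p + outArity p ≡ 2

module LogicPrograms (S : Signature) where

  open Signature S public

  record Atom : Set where
    constructor atom
    field
      pred : Pred
      ins  : Vec Term (inArity pred)
      outs : Vec Term (outArity pred)

  open Atom public

  Query : Set
  Query = List Atom

  infix 3 _⟵_

  record Clause : Set where
    constructor _⟵_
    field
      head : Atom
      body : Query

  open Clause public

  Pos : Pred → Set
  Pos p = Fin (inArity p) ⊎ Fin (outArity p)

  arg : (a : Atom) → Pos (pred a) → Term
  arg a (inj₁ i) = Vec.lookup (ins a) i
  arg a (inj₂ i) = Vec.lookup (outs a) i

  data Mark : Set where
    any  : Mark  -- "?"
    dash : Mark  -- "-"

  record Program : Set where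
    field
      clauses : List Clause
      block   : (p : Pred) → List (Pos p → Mark)

  open Program public

  _[_]ᵃ : Atom → Subst → Atom
  atom p s t [ σ ]ᵃ = atom p (s [ σ ]ᵛ) (t [ σ ]ᵛ)

  _[_]ᵠ : Query → Subst → Query
  Q [ σ ]ᵠ = map (_[ σ ]ᵃ) Q

  _[_]ᶜ : Clause → Subst → Clause
  (h ⟵ B) [ σ ]ᶜ = (h [ σ ]ᵃ) ⟵ (B [ σ ]ᵠ)

  inVars outVars varsᵃ : Atom → List Var
  inVars  a = varsᵛ (ins a)
  outVars a = varsᵛ (outs a)
  varsᵃ   a = inVars a ++ outVars a

  varsᵠ : Query → List Var
  varsᵠ = concatMap varsᵃ

  varsᶜ : Clause → List Var
  varsᶜ c = varsᵃ (head c) ++ varsᵠ (body c)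

  -- π(o₁,…,oₙ) = o_{π⁻¹(1)},…,o_{π⁻¹(n)}
  permute : (Q : Query) → Permutation′ (length Q) → Query
  permute Q π = tabulate (λ k → lookup Q (π ⟨$⟩ˡ k))

  module _ (Q : Query) (π : Permutation′ (length Q)) where

    NicelyModedQuery : Set
    NicelyModedQuery =
      Unique (concatMap outVars Q) ×
      (∀ i j → π ⟨$⟩ʳ i ≤ π ⟨$⟩ʳ j →
         Disjoint (inVars (lookup Q i)) (outVars (lookup Q j)))

    InputsTyped OutputsTyped : Subst → Fin (length Q) → Set
    InputsTyped  σ i = (ins  (lookup Q i) [ σ ]ᵛ) ∶ᵛ inType  (pred (lookup Q i))
    OutputsTyped σ i = (outs (lookup Q i) [ σ ]ᵛ) ∶ᵛ outType (pred (lookup Q i))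

    WellTypedQuery : Set
    WellTypedQuery = ∀ i σ →
      (∀ j → π ⟨$⟩ʳ j < π ⟨$⟩ʳ i → OutputsTyped σ j) → InputsTyped σ i

    OutputsAreVariables : Set
    OutputsAreVariables = All (λ a → VecAll.All IsVar (outs a)) Q

    SimplyTypedQueryBy : Set
    SimplyTypedQueryBy = NicelyModedQuery × WellTypedQuery × OutputsAreVariables

  module _ (c : Clause) (π : Permutation′ (length (body c))) where

    private
      h : Atom
      h = head c

      B : Query
      B = body c

    NicelyModedClause : Set
    NicelyModedClause =
      NicelyModedQuery B π × Disjoint (inVars h) (concatMap outVars B)

    -- As π(0) = 0 and π(n+1) = n+1, the head input t₀ precedes everything and
    -- the head output sₙ₊₁ follows everything.
    WellTypedClause : Set
    WellTypedClause =
      (∀ i σ → (ins h [ σ ]ᵛ) ∶ᵛ inType (pred h) →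
         (∀ j → π ⟨$⟩ʳ j < π ⟨$⟩ʳ i → OutputsTyped B π σ j) →
         InputsTyped B π σ i) ×
      (∀ σ → (ins h [ σ ]ᵛ) ∶ᵛ inType (pred h) →
         (∀ j → OutputsTyped B π σ j) →
         (outs h [ σ ]ᵛ) ∶ᵛ outType (pred h))

    SimplyTypedClauseBy : Set
    SimplyTypedClauseBy =
      NicelyModedClause × WellTypedClause × OutputsAreVariables B π ×
      (∀ i → Flat (Vec.lookup (ins h) i)
           × TypeConsistent (Vec.lookup (ins h) i) (inType (pred h) i)
           × (IsVariableType (inType (pred h) i) → IsVar (Vec.lookup (ins h) i)))

  SimplyTypedQuery : Query → Set
  SimplyTypedQuery Q = SimplyTypedQueryBy Q id

  PermutationSimplyTypedQuery : Query → Set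
  PermutationSimplyTypedQuery Q = ∃[ π ] SimplyTypedQueryBy Q π

  PermutationSimplyTyped : Program → Set
  PermutationSimplyTyped P = ∀ c → c ∈ clauses P → ∃[ π ] SimplyTypedClauseBy c π

  CorrespondingQuery : Query → Query → Set
  CorrespondingQuery Q Q′ = ∃[ π ] (SimplyTypedQueryBy Q π × Q′ ≡ permute Q π)

  CorrespondingClause : Clause → Clause → Set
  CorrespondingClause c c′ =
    ∃[ π ] (SimplyTypedClauseBy c π × c′ ≡ (head c ⟵ permute (body c) π))

  CorrespondingProgram : Program → Program → Set
  CorrespondingProgram P P′ =
    Pointwise CorrespondingClause (clauses P) (clauses P′) ×
    (∀ p → block P′ p ≡ block P p)

  PredicateOf : Program → Pred → Set
  PredicateOf P p = ∃[ c ] (c ∈ clauses P × p ∈ map pred (head c ∷ body c))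

  InputLinear : Program → Set
  InputLinear P =
    (∀ c → c ∈ clauses P → Unique (inVars (head c))) ×
    (∀ p → PredicateOf P p → IsEquality p → inArity p ≢ 2)

  BoundInput : Program → (p : Pred) → Fin (inArity p) → Set
  BoundInput P p i =
    ∃[ s ] ∃[ t ] ∃[ B ] ((atom p s t ⟵ B) ∈ clauses P × ¬ IsVar (Vec.lookup s i))

  BoundOutput : Program → (p : Pred) → Fin (outArity p) → Set
  BoundOutput P p i =
    ∃[ c ] ∃[ s ] ∃[ t ]
      (c ∈ clauses P × atom p s t ∈ body c × ¬ IsVar (Vec.lookup t i))

  Blocked : Program → Atom → Set
  Blocked P a =
    Any (λ b → ∀ k → b k ≡ dash → IsVar (arg a k)) (block P (pred a))

  Selectable : Program → Atom → Set
  Selectable P a = ¬ Blocked P a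

  InputSelectability : Program → Set
  InputSelectability P =
    PermutationSimplyTyped P ×
    (∀ a → PredicateOf P (pred a) →
       (∀ i → ¬ BoundOutput P (pred a) i → IsVar (Vec.lookup (outs a) i)) →
       (Selectable P a →
          ∀ i → BoundInput P (pred a) i → ¬ IsVar (Vec.lookup (ins a) i)) ×
       ((∀ i → ¬ IsVariableType (inType (pred a) i) →
            ¬ IsVar (Vec.lookup (ins a) i)) →
          Selectable P a))

  Variant : Clause → Clause → Set
  Variant c d = ∃[ σ ] (c [ σ ]ᶜ ≡ d) × ∃[ τ ] (d [ τ ]ᶜ ≡ c)

  Unifier : Subst → Atom → Atom → Set
  Unifier θ a b = a [ θ ]ᵃ ≡ b [ θ ]ᵃ

  MGU : Subst → Atom → Atom → Set
  MGU θ a b =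
    Unifier θ a b ×
    (∀ σ → Unifier σ a b → ∃[ τ ] (∀ x → σ x ≡ θ x [ τ ]))

  NonSpeculative : Program → Set
  NonSpeculative P =
    PermutationSimplyTyped P ×
    InputLinear P ×
    (∀ a → PredicateOf P (pred a) → SimplyTypedQuery (a ∷ []) →
       ∃[ c ] ∃[ d ] (c ∈ clauses P × Variant c d × Disjoint (varsᶜ d) (varsᵃ a)
                      × ∃[ θ ] Unifier θ a (head d)))

  record Step (P : Program) (Q R : Query) : Set where
    field
      before   : Query
      selected : Atom
      after    : Query
      split    : Q ≡ before ++ selected ∷ after
      clause   : Clause
      clause∈P : clause ∈ clauses P
      input    : Clause
      variant  : Variant clause input
      apart    : Disjoint (varsᶜ input) (varsᵠ Q)
      θ        : Subst
      mgu      : MGU θ selected (head input)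
      result   : R ≡ (before ++ body input ++ after) [ θ ]ᵠ

  open Step public

  -- Standardisation apart: the input clause of a step shares no variable with
  -- any earlier query or input clause of the derivation.
  record InfiniteDerivation (P : Program) (Q : Query) : Set where
    field
      query : ℕ → Query
      start : query 0 ≡ Q
      step  : ∀ n → Step P (query n) (query (suc n))
      apart-queries : ∀ m n → m ℕ.< n →
                      Disjoint (varsᶜ (input (step n))) (varsᵠ (query m))
      apart-clauses : ∀ m n → m ℕ.< n →
                      Disjoint (varsᶜ (input (step n))) (varsᶜ (input (step m)))

  open InfiniteDerivation public

  InfiniteDelayRespectingDerivation : Program → Query → Set
  InfiniteDelayRespectingDerivation P Q =
    Σ[ D ∈ InfiniteDerivation P Q ] (∀ n → Selectable P (selected (step D n)))

  InfiniteLDDerivation : Program → Query → Set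
  InfiniteLDDerivation P Q =
    Σ[ D ∈ InfiniteDerivation P Q ] (∀ n → before (step D n) ≡ [])

{-# OPTIONS --safe #-}
module Submission where

-- Input selectability and flat linear heads make every step of the given derivation a matching: the
-- head inputs are instantiated to the inputs of the selected atom, and the step only binds the output
-- variables of that atom, which occur to its right in the order of P′.  Hence steps commute, and n
-- steps of the derivation can be sorted into a run of n steps from left to right in which some atoms
-- are dropped unresolved (Run).  So Q′ has runs of every length, and this property can be preserved
-- along an LD-derivation: either the leftmost atom is resolved by one and the same clause in runs of
-- every length, and then this clause is used; or it can be dropped in runs of every length, and then
-- it may be resolved by any clause, which exists because the program is non-speculative, as runs are
-- stable under instantiation.

open import Defs
open import Algebra.Properties.CommutativeMonoid.Sum using (sum; sum-permute)
open import Axiom.ExcludedMiddle using (ExcludedMiddle)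
open import Data.Empty using (⊥; ⊥-elim)
open import Data.Fin as Fin using (Fin; zero; suc)
open import Data.Fin.Permutation using (Permutation′; _⟨$⟩ʳ_; _⟨$⟩ˡ_; flip; inverseˡ; inverseʳ)
import Data.Fin.Properties as Finₚ
open import Data.List using (List; []; _∷_; _++_; map; concatMap; tabulate; lookup)
open import Data.List.Membership.Propositional using (_∈_; _∉_)
open import Data.List.Membership.Propositional.Properties using (∈-++⁺ˡ; ∈-++⁺ʳ; ∈-++⁻; ∈-map⁻; ∈-map⁺; ∈-∃++; ∈-lookup; ∈-insert)
open import Data.List.Properties using (map-++; ++-assoc; tabulate-lookup; ∷-injective)
open import Data.List.Relation.Binary.Disjoint.Propositional using (Disjoint)
open import Data.List.Relation.Binary.Permutation.Propositional using (_↭_; ↭-sym; ↭-trans; ↭-reflexive; ↭⇒↭ₛ)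
import Data.List.Relation.Binary.Permutation.Propositional.Properties as ↭
import Data.List.Relation.Binary.Permutation.Setoid.Properties as ↭ₛ
open import Data.List.Relation.Binary.Pointwise using (Pointwise; []; _∷_)
open import Data.List.Relation.Unary.All as All using (All; []; _∷_)
import Data.List.Relation.Unary.All.Properties as Allₚ
open import Data.List.Relation.Unary.AllPairs as AllPairs using (AllPairs; []; _∷_)
import Data.List.Relation.Unary.AllPairs.Properties as AllPairsₚ
open import Data.List.Relation.Unary.Any using (here; there)
open import Data.List.Relation.Unary.Unique.Propositional using (Unique)
import Data.List.Relation.Unary.Unique.Propositional.Properties as Uniqueₚ
open import Data.Nat using (ℕ; zero; suc; _+_; _∸_; _≤_; _<_; _<?_; s≤s; _⊔_)
open import Data.Nat.Properties as ℕₚ using ()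
open import Data.List.Extrema ℕₚ.≤-totalOrder using (max; xs≤max)
open import Data.List.Membership.DecPropositional ℕₚ._≟_ using (_∈?_)
open import Data.Product using (∃-syntax; _×_; _,_; proj₁; proj₂)
open import Data.Sum using (_⊎_; inj₁; inj₂)
open import Data.Unit using (⊤; tt)
open import Data.Vec using (Vec; []; _∷_)
import Data.Vec as Vec
import Data.Vec.Relation.Unary.All as VecAll
import Data.Vec.Relation.Unary.All.Properties as VecAllₚ
open import Function using (_∘_; case_of_)
open import Level using (0ℓ)
open import Relation.Binary.PropositionalEquality using (_≡_; refl; sym; trans; cong; cong₂; subst; subst₂; setoid; module ≡-Reasoning)
open import Relation.Nullary using (¬_; yes; no; contradiction)

-- Lists: splitting, pairwise relations, reordering

module _ {A : Set} where

  Unique-++⁻ : (xs : List A) {ys : List A} → Unique (xs ++ ys) → Unique xs × Unique ys × Disjoint xs ys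
  Unique-++⁻ [] u = [] , u , λ { (() , _) }
  Unique-++⁻ (x ∷ xs) (x∉ ∷ u) with Unique-++⁻ xs u
  ... | uxs , uys , d =
    Allₚ.++⁻ˡ xs x∉ ∷ uxs , uys ,
    λ { (here refl , y∈) → All.lookup (Allₚ.++⁻ʳ xs x∉) y∈ refl
      ; (there x∈ , y∈) → d (x∈ , y∈) }

  AllPairs-++⁻ : {R : A → A → Set} (xs : List A) {ys : List A} → AllPairs R (xs ++ ys) →
    AllPairs R xs × AllPairs R ys × All (λ x → All (R x) ys) xs
  AllPairs-++⁻ [] p = [] , p , []
  AllPairs-++⁻ (x ∷ xs) (px ∷ p) with AllPairs-++⁻ xs p
  ... | pxs , pys , q = Allₚ.++⁻ˡ xs px ∷ pxs , pys , Allₚ.++⁻ʳ xs px ∷ q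

  AllPairs-mapWith : {P : A → Set} {R R′ : A → A → Set} → (∀ {x y} → P x → P y → R x y → R′ x y) →
    ∀ {xs} → All P xs → AllPairs R xs → AllPairs R′ xs
  AllPairs-mapWith f [] [] = []
  AllPairs-mapWith f (px ∷ pxs) (r ∷ rs) = All.zipWith (λ (py , q) → f px py q) (pxs , r) ∷ AllPairs-mapWith f pxs rs

module _ {A : Set} where

  -- Up to `_↭_` the lists under `_++_` form a commutative monoid, and `tabulate f` is a sum of
  -- singletons in it, so this is the invariance of finite sums under permutation.
  tabulate-permute : ∀ {n} (f : Fin n → A) (π : Permutation′ n) → tabulate (f ∘ (π ⟨$⟩ˡ_)) ↭ tabulate f
  tabulate-permute f π = ↭-trans (↭-reflexive (tabulate-sum (f ∘ (π ⟨$⟩ˡ_))))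
    (↭-trans (↭-sym (sum-permute M (λ i → f i ∷ []) (flip π))) (↭-reflexive (sym (tabulate-sum f))))
    where
    M = ↭.++-commutativeMonoid

    tabulate-sum : ∀ {n} (f : Fin n → A) → tabulate f ≡ sum M (λ i → f i ∷ [])
    tabulate-sum {zero} f = refl
    tabulate-sum {suc n} f = cong (f zero ∷_) (tabulate-sum (f ∘ suc))

  concatMap-Unique⁻ : {B : Set} (f : A → List B) (xs : List A) → Unique (concatMap f xs) →
    All (Unique ∘ f) xs × AllPairs (λ x y → Disjoint (f x) (f y)) xs
  concatMap-Unique⁻ f [] _ = [] , []
  concatMap-Unique⁻ f (x ∷ xs) u with Unique-++⁻ (f x) u
  ... | ux , uxs , d =
    let us , ps = concatMap-Unique⁻ f xs uxs
    in ux ∷ us , apart xs d ∷ ps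
    where
    apart : ∀ ys → Disjoint (f x) (concatMap f ys) → All (λ y → Disjoint (f x) (f y)) ys
    apart [] d = []
    apart (y ∷ ys) d = (λ (p , q) → d (p , ∈-++⁺ˡ q)) ∷ apart ys (λ (p , q) → d (p , ∈-++⁺ʳ (f y) q))

  Pointwise-∈ˡ : {B : Set} {R : A → B → Set} {xs : List A} {ys : List B} → Pointwise R xs ys →
    ∀ {x} → x ∈ xs → ∃[ y ] (y ∈ ys × R x y)
  Pointwise-∈ˡ (r ∷ rs) (here refl) = _ , here refl , r
  Pointwise-∈ˡ (r ∷ rs) (there x∈) = let y , y∈ , r′ = Pointwise-∈ˡ rs x∈ in y , there y∈ , r′

  Pointwise-∈ʳ : {B : Set} {R : B → A → Set} {xs : List B} {ys : List A} → Pointwise R xs ys →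
    ∀ {y} → y ∈ ys → ∃[ x ] (x ∈ xs × R x y)
  Pointwise-∈ʳ (r ∷ rs) (here refl) = _ , here refl , r
  Pointwise-∈ʳ (r ∷ rs) (there y∈) = let x , x∈ , r′ = Pointwise-∈ʳ rs y∈ in x , there x∈ , r′

-- Substitutions and their action on variables

module Substitution (S : Signature) where

  open LogicPrograms S

  infixl 7 _⨟_

  _⨟_ : Subst → Subst → Subst
  (σ ⨟ τ) x = σ x [ τ ]

  mutual
    []-cong : ∀ t {σ τ} → (∀ x → x ∈ vars t → σ x ≡ τ x) → t [ σ ] ≡ t [ τ ]
    []-cong (var x) eq = eq x (here refl)
    []-cong (fun f ts) eq = cong (fun f) ([]ᵛ-cong ts eq)

    []ᵛ-cong : ∀ {n} (ts : Vec Term n) {σ τ} → (∀ x → x ∈ varsᵛ ts → σ x ≡ τ x) → ts [ σ ]ᵛ ≡ ts [ τ ]ᵛ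
    []ᵛ-cong [] eq = refl
    []ᵛ-cong (t ∷ ts) eq =
      cong₂ _∷_ ([]-cong t (λ x → eq x ∘ ∈-++⁺ˡ)) ([]ᵛ-cong ts (λ x → eq x ∘ ∈-++⁺ʳ (vars t)))

  fun-injective : ∀ {f ts us} → fun f ts ≡ fun f us → ts ≡ us
  fun-injective refl = refl

  ∷ᵛ-injective : ∀ {n t u} {ts us : Vec Term n} → t Vec.∷ ts ≡ u ∷ us → t ≡ u × ts ≡ us
  ∷ᵛ-injective refl = refl , refl

  mutual
    -- Substitution acts at each occurrence separately. This turns equations between instances into
    -- equations between substitutions, for example when a renaming has to be shown invertible.
    []-cong⁻ : ∀ t {σ τ} → t [ σ ] ≡ t [ τ ] → ∀ {x} → x ∈ vars t → σ x ≡ τ x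
    []-cong⁻ (var x) eq (here refl) = eq
    []-cong⁻ (fun f ts) eq x∈ = []ᵛ-cong⁻ ts (fun-injective eq) x∈

    []ᵛ-cong⁻ : ∀ {n} (ts : Vec Term n) {σ τ} → ts [ σ ]ᵛ ≡ ts [ τ ]ᵛ → ∀ {x} → x ∈ varsᵛ ts → σ x ≡ τ x
    []ᵛ-cong⁻ (t ∷ ts) eq x∈ with ∈-++⁻ (vars t) x∈
    ... | inj₁ x∈t  = []-cong⁻ t (proj₁ (∷ᵛ-injective eq)) x∈t
    ... | inj₂ x∈ts = []ᵛ-cong⁻ ts (proj₂ (∷ᵛ-injective eq)) x∈ts

  mutual
    []-⨟ : ∀ t {σ τ} → t [ σ ] [ τ ] ≡ t [ σ ⨟ τ ]
    []-⨟ (var x) = refl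
    []-⨟ (fun f ts) = cong (fun f) ([]ᵛ-⨟ ts)

    []ᵛ-⨟ : ∀ {n} (ts : Vec Term n) {σ τ} → ts [ σ ]ᵛ [ τ ]ᵛ ≡ ts [ σ ⨟ τ ]ᵛ
    []ᵛ-⨟ [] = refl
    []ᵛ-⨟ (t ∷ ts) = cong₂ _∷_ ([]-⨟ t) ([]ᵛ-⨟ ts)

  mutual
    []-var : ∀ t → t [ var ] ≡ t
    []-var (var x) = refl
    []-var (fun f ts) = cong (fun f) ([]ᵛ-var ts)

    []ᵛ-var : ∀ {n} (ts : Vec Term n) → ts [ var ]ᵛ ≡ ts
    []ᵛ-var [] = refl
    []ᵛ-var (t ∷ ts) = cong₂ _∷_ ([]-var t) ([]ᵛ-var ts)

  mutual
    vars-[]⁻ : ∀ t {σ z} → z ∈ vars (t [ σ ]) → ∃[ x ] (x ∈ vars t × z ∈ vars (σ x))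
    vars-[]⁻ (var x) z∈ = x , here refl , z∈
    vars-[]⁻ (fun f ts) z∈ = varsᵛ-[]⁻ ts z∈

    varsᵛ-[]⁻ : ∀ {n} (ts : Vec Term n) {σ z} → z ∈ varsᵛ (ts [ σ ]ᵛ) → ∃[ x ] (x ∈ varsᵛ ts × z ∈ vars (σ x))
    varsᵛ-[]⁻ (t ∷ ts) {σ} z∈ with ∈-++⁻ (vars (t [ σ ])) z∈
    ... | inj₁ z∈t  = let x , x∈ , z∈σ = vars-[]⁻ t z∈t in x , ∈-++⁺ˡ x∈ , z∈σ
    ... | inj₂ z∈ts = let x , x∈ , z∈σ = varsᵛ-[]⁻ ts z∈ts in x , ∈-++⁺ʳ (vars t) x∈ , z∈σ

  mutual
    vars-[]⁺ : ∀ t {σ x z} → x ∈ vars t → z ∈ vars (σ x) → z ∈ vars (t [ σ ])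
    vars-[]⁺ (var x) (here refl) z∈ = z∈
    vars-[]⁺ (fun f ts) x∈ z∈ = varsᵛ-[]⁺ ts x∈ z∈

    varsᵛ-[]⁺ : ∀ {n} (ts : Vec Term n) {σ x z} → x ∈ varsᵛ ts → z ∈ vars (σ x) → z ∈ varsᵛ (ts [ σ ]ᵛ)
    varsᵛ-[]⁺ (t ∷ ts) {σ} x∈ z∈ with ∈-++⁻ (vars t) x∈
    ... | inj₁ x∈t  = ∈-++⁺ˡ (vars-[]⁺ t x∈t z∈)
    ... | inj₂ x∈ts = ∈-++⁺ʳ (vars (t [ σ ])) (varsᵛ-[]⁺ ts x∈ts z∈)

  mutual
    -- An equation of lists, not of sets, so that `Unique` can be carried through the renaming.
    vars-rename : ∀ t {σ} g → (∀ x → x ∈ vars t → σ x ≡ var (g x)) → vars (t [ σ ]) ≡ map g (vars t)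
    vars-rename (var x) g eq = cong vars (eq x (here refl))
    vars-rename (fun f ts) g eq = varsᵛ-rename ts g eq

    varsᵛ-rename : ∀ {n} (ts : Vec Term n) {σ} g → (∀ x → x ∈ varsᵛ ts → σ x ≡ var (g x)) →
      varsᵛ (ts [ σ ]ᵛ) ≡ map g (varsᵛ ts)
    varsᵛ-rename [] g eq = refl
    varsᵛ-rename (t ∷ ts) g eq =
      trans (cong₂ _++_ (vars-rename t g (λ x → eq x ∘ ∈-++⁺ˡ)) (varsᵛ-rename ts g (λ x → eq x ∘ ∈-++⁺ʳ (vars t))))
            (sym (map-++ g (vars t) (varsᵛ ts)))

  lookup-[] : ∀ {n} (ts : Vec Term n) {σ} i → Vec.lookup (ts [ σ ]ᵛ) i ≡ Vec.lookup ts i [ σ ]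
  lookup-[] (t ∷ ts) zero = refl
  lookup-[] (t ∷ ts) (suc i) = lookup-[] ts i

  IsVar-[]⁻ : ∀ t {σ} → IsVar (t [ σ ]) → IsVar t
  IsVar-[]⁻ (var x) _ = isVar x

  atom-cong : ∀ {p s s′ t t′} → s ≡ s′ → t ≡ t′ → atom p s t ≡ atom p s′ t′
  atom-cong refl refl = refl

  atom-injective : ∀ {p s s′ t t′} → atom p s t ≡ atom p s′ t′ → s ≡ s′ × t ≡ t′
  atom-injective refl = refl , refl

  []ᵃ-cong : ∀ a {σ τ} → (∀ x → x ∈ varsᵃ a → σ x ≡ τ x) → a [ σ ]ᵃ ≡ a [ τ ]ᵃ
  []ᵃ-cong (atom p s t) eq =
    atom-cong ([]ᵛ-cong s (λ x → eq x ∘ ∈-++⁺ˡ)) ([]ᵛ-cong t (λ x → eq x ∘ ∈-++⁺ʳ (varsᵛ s)))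

  []ᵃ-cong⁻ : ∀ a {σ τ} → a [ σ ]ᵃ ≡ a [ τ ]ᵃ → ∀ {x} → x ∈ varsᵃ a → σ x ≡ τ x
  []ᵃ-cong⁻ (atom p s t) eq x∈ with atom-injective eq | ∈-++⁻ (varsᵛ s) x∈
  ... | eqs , _ | inj₁ x∈s = []ᵛ-cong⁻ s eqs x∈s
  ... | _ , eqt | inj₂ x∈t = []ᵛ-cong⁻ t eqt x∈t

  []ᵃ-⨟ : ∀ a {σ τ} → a [ σ ]ᵃ [ τ ]ᵃ ≡ a [ σ ⨟ τ ]ᵃ
  []ᵃ-⨟ (atom p s t) = atom-cong ([]ᵛ-⨟ s) ([]ᵛ-⨟ t)

  []ᵃ-var : ∀ a → a [ var ]ᵃ ≡ a
  []ᵃ-var (atom p s t) = atom-cong ([]ᵛ-var s) ([]ᵛ-var t)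

  varsᵃ-[]⁻ : ∀ a {σ z} → z ∈ varsᵃ (a [ σ ]ᵃ) → ∃[ x ] (x ∈ varsᵃ a × z ∈ vars (σ x))
  varsᵃ-[]⁻ (atom p s t) {σ} z∈ with ∈-++⁻ (varsᵛ (s [ σ ]ᵛ)) z∈
  ... | inj₁ z∈s = let x , x∈ , z∈σ = varsᵛ-[]⁻ s z∈s in x , ∈-++⁺ˡ x∈ , z∈σ
  ... | inj₂ z∈t = let x , x∈ , z∈σ = varsᵛ-[]⁻ t z∈t in x , ∈-++⁺ʳ (varsᵛ s) x∈ , z∈σ

  []ᵠ-cong : ∀ Q {σ τ} → (∀ x → x ∈ varsᵠ Q → σ x ≡ τ x) → Q [ σ ]ᵠ ≡ Q [ τ ]ᵠ
  []ᵠ-cong [] eq = refl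
  []ᵠ-cong (a ∷ Q) eq = cong₂ _∷_ ([]ᵃ-cong a (λ x → eq x ∘ ∈-++⁺ˡ)) ([]ᵠ-cong Q (λ x → eq x ∘ ∈-++⁺ʳ (varsᵃ a)))

  []ᵠ-⨟ : ∀ Q {σ τ} → Q [ σ ]ᵠ [ τ ]ᵠ ≡ Q [ σ ⨟ τ ]ᵠ
  []ᵠ-⨟ [] = refl
  []ᵠ-⨟ (a ∷ Q) = cong₂ _∷_ ([]ᵃ-⨟ a) ([]ᵠ-⨟ Q)

  []ᵠ-var : ∀ Q → Q [ var ]ᵠ ≡ Q
  []ᵠ-var [] = refl
  []ᵠ-var (a ∷ Q) = cong₂ _∷_ ([]ᵃ-var a) ([]ᵠ-var Q)

  []ᵠ-++ : ∀ A {C σ} → (A ++ C) [ σ ]ᵠ ≡ A [ σ ]ᵠ ++ C [ σ ]ᵠ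
  []ᵠ-++ A {C} = map-++ _ A C

  []ᵠ-cong⁻ : ∀ Q {σ τ} → Q [ σ ]ᵠ ≡ Q [ τ ]ᵠ → ∀ {x} → x ∈ varsᵠ Q → σ x ≡ τ x
  []ᵠ-cong⁻ (a ∷ Q) eq x∈ with ∷-injective eq | ∈-++⁻ (varsᵃ a) x∈
  ... | eqa , _ | inj₁ x∈a = []ᵃ-cong⁻ a eqa x∈a
  ... | _ , eqQ | inj₂ x∈Q = []ᵠ-cong⁻ Q eqQ x∈Q

  varsᵠ-[]⁻ : ∀ Q {σ z} → z ∈ varsᵠ (Q [ σ ]ᵠ) → ∃[ x ] (x ∈ varsᵠ Q × z ∈ vars (σ x))
  varsᵠ-[]⁻ (a ∷ Q) {σ} z∈ with ∈-++⁻ (varsᵃ (a [ σ ]ᵃ)) z∈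
  ... | inj₁ z∈a = let x , x∈ , z∈σ = varsᵃ-[]⁻ a z∈a in x , ∈-++⁺ˡ x∈ , z∈σ
  ... | inj₂ z∈Q = let x , x∈ , z∈σ = varsᵠ-[]⁻ Q z∈Q in x , ∈-++⁺ʳ (varsᵃ a) x∈ , z∈σ

  ∈-varsᵠ : ∀ {Q a x} → a ∈ Q → x ∈ varsᵃ a → x ∈ varsᵠ Q
  ∈-varsᵠ (here refl) x∈ = ∈-++⁺ˡ x∈
  ∈-varsᵠ {b ∷ Q} (there a∈) x∈ = ∈-++⁺ʳ (varsᵃ b) (∈-varsᵠ a∈ x∈)

  varsᵠ⁻ : ∀ Q {x} → x ∈ varsᵠ Q → ∃[ a ] (a ∈ Q × x ∈ varsᵃ a)
  varsᵠ⁻ (b ∷ Q) x∈ with ∈-++⁻ (varsᵃ b) x∈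
  ... | inj₁ x∈b = b , here refl , x∈b
  ... | inj₂ x∈Q = let a , a∈ , x∈a = varsᵠ⁻ Q x∈Q in a , there a∈ , x∈a

  varsᵠ-⊆ : ∀ {Q R x} → (∀ {a} → a ∈ Q → a ∈ R) → x ∈ varsᵠ Q → x ∈ varsᵠ R
  varsᵠ-⊆ {Q} Q⊆R x∈ = let a , a∈ , x∈a = varsᵠ⁻ Q x∈ in ∈-varsᵠ (Q⊆R a∈) x∈a

  -- Matching of linear and flat heads

  match-linear : ∀ {n} (ts us : Vec Term n) → Unique (varsᵛ ts) →
    (∀ i → ∃[ σ ] (Vec.lookup ts i [ σ ] ≡ Vec.lookup us i)) → ∃[ σ ] (ts [ σ ]ᵛ ≡ us)
  match-linear [] [] _ _ = var , refl
  match-linear (t ∷ ts) (u ∷ us) lin m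
    with Unique-++⁻ (vars t) lin
  ... | _ , lin-ts , disj with m zero | match-linear ts us lin-ts (m ∘ suc)
  ... | σ₁ , eq₁ | σ₂ , eq₂ = σ , cong₂ _∷_ (trans ([]-cong t on-t) eq₁) (trans ([]ᵛ-cong ts on-ts) eq₂)
    where
    -- By linearity `t` and `ts` share no variable, so their separate matchers can be glued.
    σ : Subst
    σ x with x ∈? vars t
    ... | yes _ = σ₁ x
    ... | no  _ = σ₂ x

    on-t : ∀ x → x ∈ vars t → σ x ≡ σ₁ x
    on-t x x∈ with x ∈? vars t
    ... | yes _  = refl
    ... | no x∉  = contradiction x∈ x∉

    on-ts : ∀ x → x ∈ varsᵛ ts → σ x ≡ σ₂ x
    on-ts x x∈ with x ∈? vars t
    ... | yes x∈t = ⊥-elim (disj (x∈t , x∈))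
    ... | no  _   = refl

  match-vars : ∀ {n} (ts us : Vec Term n) → Unique (varsᵛ ts) → VecAll.All IsVar ts → ∃[ σ ] (ts [ σ ]ᵛ ≡ us)
  match-vars ts us lin vs = match-linear ts us lin (λ i → match-var (VecAllₚ.lookup⁺ vs i))
    where
    match-var : ∀ {t u} → IsVar t → ∃[ σ ] (t [ σ ] ≡ u)
    match-var (isVar x) = (λ _ → _) , refl

  map-var-IsVar : ∀ {n} (xs : Vec Var n) → VecAll.All IsVar (Vec.map var xs)
  map-var-IsVar [] = VecAll.[]
  map-var-IsVar (x ∷ xs) = isVar x VecAll.∷ map-var-IsVar xs

  linear-lookup : ∀ {n} (ts : Vec Term n) → Unique (varsᵛ ts) → ∀ i → Unique (vars (Vec.lookup ts i))
  linear-lookup (t ∷ ts) u zero = proj₁ (Unique-++⁻ (vars t) u)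
  linear-lookup (t ∷ ts) u (suc i) = linear-lookup ts (proj₁ (proj₂ (Unique-++⁻ (vars t) u))) i

  -- If both terms are compound, unifiability equates their outermost symbols, and below it `t` has
  -- distinct variables, which match anything. The condition on variables excludes the case in which
  -- unification would have to bind `u`.
  match-flat : ∀ {t u θ θ′} → Flat t → Unique (vars t) → (¬ IsVar t → ¬ IsVar u) →
    t [ θ ] ≡ u [ θ′ ] → ∃[ σ ] (t [ σ ] ≡ u)
  match-flat {u = u} (flat-var x) _ _ _ = (λ _ → u) , refl
  match-flat {u = var y} (flat-fun f xs _) _ nv _ = contradiction (isVar y) (nv λ ())
  match-flat {u = fun g us} (flat-fun f xs _) lin _ eq with fun-head eq
    where
    fun-head : ∀ {f g ts us} → fun f ts ≡ fun g us → f ≡ g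
    fun-head refl = refl
  ... | refl = let σ , e = match-vars (Vec.map var xs) us lin (map-var-IsVar xs) in σ , cong (fun f) e

  -- The head instance may have arbitrary outputs: only inputs are consumed.
  Matches : Atom → Atom → Set
  Matches h a = ∃[ σ ] ∃[ v ] (h [ σ ]ᵃ ≡ atom (pred a) (ins a) v)

  Matches-[] : ∀ {h} a {τ} → Matches h a → Matches h (a [ τ ]ᵃ)
  Matches-[] {h} (atom p s t) {τ} (σ , v , eq) =
    σ ⨟ τ , v [ τ ]ᵛ , trans (sym ([]ᵃ-⨟ h)) (cong (_[ τ ]ᵃ) eq)

  -- `K` separates the two sides: outside it the head has variables, inside it the atom has none. It
  -- is instantiated to the bound positions for atoms selected in the given derivation, and to the
  -- positions of non-variable type when a clause is sought for an LD-step.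
  unifiable⇒Matches : (K : (p : Pred) → Fin (inArity p) → Set) → ∀ h a {θ θ′} →
    (∀ i → Flat (Vec.lookup (ins h) i)) → Unique (inVars h) → h [ θ ]ᵃ ≡ a [ θ′ ]ᵃ →
    (∀ i → ¬ IsVar (Vec.lookup (ins h) i) → K (pred h) i) →
    (∀ i → K (pred a) i → ¬ IsVar (Vec.lookup (ins a) i)) → Matches h a
  unifiable⇒Matches K (atom p s t) (atom q s′ t′) flat lin eq hK aK with cong pred eq
  ... | refl = let σ , e = match-linear s s′ lin pos in σ , t [ σ ]ᵛ , atom-cong e refl
    where
    pos : ∀ i → ∃[ σ ] (Vec.lookup s i [ σ ] ≡ Vec.lookup s′ i)
    pos i = match-flat (flat i) (linear-lookup s lin i) (aK i ∘ hK i)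
      (trans (sym (lookup-[] s i))
        (trans (cong (λ v → Vec.lookup v i) (proj₁ (atom-injective eq))) (lookup-[] s′ i)))

  -- Moding of atoms, queries and clauses

  ModedAtom : Atom → Set
  ModedAtom a = VecAll.All IsVar (outs a) × Unique (outVars a) × Disjoint (inVars a) (outVars a)

  infix 4 _⋈_

  -- To be read with `a` to the left of `b`: the inputs of `b` may contain output variables of `a`,
  -- but data never flow from right to left.
  _⋈_ : Atom → Atom → Set
  a ⋈ b = Disjoint (outVars a) (outVars b) × Disjoint (inVars a) (outVars b)

  SimplyModed : Query → Set
  SimplyModed Q = All ModedAtom Q × AllPairs _⋈_ Q

  record SimplyModedClause (c : Clause) : Set where
    field
      body-moded   : SimplyModed (body c)
      head-apart   : All (λ b → Disjoint (inVars (head c)) (outVars b)) (body c)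
      input-linear : Unique (inVars (head c))

  -- Resolvers: canonical most general unifiers for matching heads

  shift : ℕ → Subst
  shift N x = var (N + x)

  below-or-shifted : ℕ → Subst → Subst → Subst
  below-or-shifted N ρ σ z with z <? N
  ... | yes _ = ρ z
  ... | no  _ = σ (z ∸ N)

  below : ∀ {N ρ σ z} → z < N → below-or-shifted N ρ σ z ≡ ρ z
  below {N} {z = z} z<N with z <? N
  ... | yes _ = refl
  ... | no z≮N = contradiction z<N z≮N

  shifted : ∀ {ρ σ} N x → below-or-shifted N ρ σ (N + x) ≡ σ x
  shifted {σ = σ} N x with N + x <? N
  ... | yes N+x<N = contradiction N+x<N (ℕₚ.m+n≮m N x)
  ... | no _ = cong σ (ℕₚ.m+n∸m≡n N x)

  -- ρ acts on the variables of the query and σ on those of the program clause; the clause variables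
  -- that are not determined by the matching are renamed by shift N.
  record Resolver (N : ℕ) (b h : Atom) : Set where
    field
      ρ σ     : Subst
      unifies : h [ σ ]ᵃ ≡ b [ ρ ]ᵃ
      ρ-fixes : ∀ {x} → x ∉ outVars b → ρ x ≡ var x
      σ-input : ∀ {x z} → x ∈ inVars h → z ∈ vars (σ x) → z ∈ inVars b
      σ-local : ∀ {x} → x ∉ inVars h → σ x ≡ var (N + x)
      general : ∀ ψ → b [ ψ ]ᵃ ≡ h [ shift N ]ᵃ [ ψ ]ᵃ →
                (∀ x → ρ x [ ψ ] ≡ ψ x) × (∀ x → σ x [ ψ ] ≡ ψ (N + x))

  -- The inputs are settled by matching, which binds head variables only. The outputs of `b` are
  -- distinct variables that avoid its inputs, so they can be set to the instantiated head outputs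
  -- without disturbing the inputs.
  resolver : ∀ N b h → ModedAtom b → Matches h b → Resolver N b h
  resolver N (atom p _ t) (atom p t₀ s′) (vs , lin , disj) (σ₀ , _ , refl) = record
    { ρ = ρ ; σ = σ ; unifies = atom-cong (sym ins-ρ) (sym outs-ρ) ; ρ-fixes = ρ-off ; σ-input = σ-input
    ; σ-local = σ-off ; general = λ ψ eq → ρψ ψ (atom-injective eq) , σψ ψ (atom-injective eq) }
    where
    -- Matching on `refl` has replaced the inputs of `b` by this instance.
    s = t₀ [ σ₀ ]ᵛ

    σ : Subst
    σ x with x ∈? varsᵛ t₀
    ... | yes _ = σ₀ x
    ... | no  _ = var (N + x)

    σ-on : ∀ {x} → x ∈ varsᵛ t₀ → σ x ≡ σ₀ x
    σ-on {x} x∈ with x ∈? varsᵛ t₀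
    ... | yes _ = refl
    ... | no x∉ = contradiction x∈ x∉

    σ-off : ∀ {x} → x ∉ varsᵛ t₀ → σ x ≡ var (N + x)
    σ-off {x} x∉ with x ∈? varsᵛ t₀
    ... | yes x∈ = contradiction x∈ x∉
    ... | no _   = refl

    outs-matched = match-vars t (s′ [ σ ]ᵛ) lin vs
    ρ₀ = proj₁ outs-matched

    ρ : Subst
    ρ x with x ∈? varsᵛ t
    ... | yes _ = ρ₀ x
    ... | no  _ = var x

    ρ-on : ∀ {x} → x ∈ varsᵛ t → ρ x ≡ ρ₀ x
    ρ-on {x} x∈ with x ∈? varsᵛ t
    ... | yes _ = refl
    ... | no x∉ = contradiction x∈ x∉

    ρ-off : ∀ {x} → x ∉ varsᵛ t → ρ x ≡ var x
    ρ-off {x} x∉ with x ∈? varsᵛ t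
    ... | yes x∈ = contradiction x∈ x∉
    ... | no _   = refl

    ins-σ : t₀ [ σ ]ᵛ ≡ s
    ins-σ = []ᵛ-cong t₀ (λ x → σ-on)

    ins-ρ : s [ ρ ]ᵛ ≡ t₀ [ σ ]ᵛ
    ins-ρ = trans ([]ᵛ-cong s (λ x x∈ → ρ-off (λ x∈t → disj (x∈ , x∈t)))) (trans ([]ᵛ-var s) (sym ins-σ))

    outs-ρ : t [ ρ ]ᵛ ≡ s′ [ σ ]ᵛ
    outs-ρ = trans ([]ᵛ-cong t (λ x → ρ-on)) (proj₂ outs-matched)

    σ-input : ∀ {x z} → x ∈ varsᵛ t₀ → z ∈ vars (σ x) → z ∈ varsᵛ s
    σ-input x∈ z∈ = varsᵛ-[]⁺ t₀ x∈ (subst (λ u → _ ∈ vars u) (σ-on x∈) z∈)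

    module _ (ψ : Subst) (eqs : s [ ψ ]ᵛ ≡ t₀ [ shift N ]ᵛ [ ψ ]ᵛ × t [ ψ ]ᵛ ≡ s′ [ shift N ]ᵛ [ ψ ]ᵛ) where

      σψ : ∀ x → σ x [ ψ ] ≡ ψ (N + x)
      σψ x = case x ∈? varsᵛ t₀ of λ where
        (no x∉) → cong (_[ ψ ]) (σ-off x∉)
        (yes x∈) → []ᵛ-cong⁻ t₀ {σ ⨟ ψ} {shift N ⨟ ψ}
          (trans (sym ([]ᵛ-⨟ t₀)) (trans (cong (_[ ψ ]ᵛ) ins-σ) (trans (proj₁ eqs) ([]ᵛ-⨟ t₀)))) x∈

      ρψ : ∀ x → ρ x [ ψ ] ≡ ψ x
      ρψ x = case x ∈? varsᵛ t of λ where
        (no x∉) → cong (_[ ψ ]) (ρ-off x∉)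
        (yes x∈) → []ᵛ-cong⁻ t {ρ ⨟ ψ} {ψ}
          (trans (sym ([]ᵛ-⨟ t)) (trans (cong (_[ ψ ]ᵛ) outs-ρ) (trans ([]ᵛ-⨟ s′)
            (trans ([]ᵛ-cong s′ (λ x _ → σψ x)) (trans (sym ([]ᵛ-⨟ s′)) (sym (proj₂ eqs))))))) x∈

  -- Resolvents and the persistence of moding

  module Resolution {N : ℕ} {b : Atom} {c : Clause} (r : Resolver N b (head c)) where

    open Resolver r

    private
      h = head c

    -- The given pair is glued into one substitution on query variables and shifted clause
    -- variables. It unifies `b` with the renamed head, so `general` makes it the factor.
    factor : (∀ {x} → x ∈ varsᵃ b → x < N) → ∀ {ρ′ σ′} → h [ σ′ ]ᵃ ≡ b [ ρ′ ]ᵃ →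
      ∃[ τ ] ((∀ {x} → x < N → ρ x [ τ ] ≡ ρ′ x) × (∀ x → σ x [ τ ] ≡ σ′ x))
    factor bnd {ρ′} {σ′} eq = ψ , (λ {x} x<N → trans (proj₁ g x) (below x<N)) , λ x → trans (proj₂ g x) (shifted N x)
      where
      ψ = below-or-shifted N ρ′ σ′
      g = general ψ (trans ([]ᵃ-cong b (λ x x∈ → below (bnd x∈)))
                    (trans (sym eq)
                    (trans ([]ᵃ-cong h (λ x _ → sym (shifted N x))) (sym ([]ᵃ-⨟ h)))))

    -- Together with `ρ-vars` this bounds what a step can introduce: only input variables of `b` and
    -- variables from `N` on.
    σ-vars : ∀ {x z} → z ∈ vars (σ x) → z ∈ inVars b ⊎ (z ≡ N + x)
    σ-vars {x} z∈ with x ∈? inVars h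
    ... | yes x∈ = inj₁ (σ-input x∈ z∈)
    ... | no x∉ with subst (λ u → _ ∈ vars u) (σ-local x∉) z∈
    ... | here eq = inj₂ eq

    ρ-vars : ∀ {x z} → z ∈ vars (ρ x) → (z ≡ x) ⊎ z ∈ inVars b ⊎ N ≤ z
    ρ-vars {x} {z} z∈ with x ∈? outVars b
    ρ-vars {x} {z} z∈ | no x∉ with subst (λ u → _ ∈ vars u) (ρ-fixes x∉) z∈
    ... | here eq = inj₁ eq
    ρ-vars {x} {z} z∈ | yes x∈ with varsᵛ-[]⁻ (outs h) (subst (λ a → z ∈ outVars a) (sym unifies) (varsᵛ-[]⁺ (outs b) x∈ z∈))
    ... | x′ , _ , z∈σ with σ-vars z∈σ
    ... | inj₁ z∈b = inj₂ (inj₁ z∈b)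
    ... | inj₂ refl = inj₂ (inj₂ (ℕₚ.m≤m+n N x′))

    -- A step binds only output variables of `b`, and atoms to its left contain none of them. This
    -- is why steps commute.
    ρ-apart : ∀ {a} → a ⋈ b → a [ ρ ]ᵃ ≡ a
    ρ-apart {a} (oo , io) = trans ([]ᵃ-cong a fix) ([]ᵃ-var a)
      where
      fix : ∀ x → x ∈ varsᵃ a → ρ x ≡ var x
      fix x x∈ with ∈-++⁻ (inVars a) x∈
      ... | inj₁ x∈i = ρ-fixes (λ x∈b → io (x∈i , x∈b))
      ... | inj₂ x∈o = ρ-fixes (λ x∈b → oo (x∈o , x∈b))

    ρ-outs : ∀ {a} → b ⋈ a → outs a [ ρ ]ᵛ ≡ outs a
    ρ-outs {a} (oo , _) = trans ([]ᵛ-cong (outs a) (λ x x∈ → ρ-fixes (λ x∈b → oo (x∈b , x∈)))) ([]ᵛ-var (outs a))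

    σ-outs : ∀ {a} → Disjoint (inVars h) (outVars a) → ∀ x → x ∈ outVars a → σ x ≡ var (N + x)
    σ-outs d x x∈ = σ-local (λ x∈h → d (x∈h , x∈))

    σ-outVars : ∀ {a} → Disjoint (inVars h) (outVars a) → ∀ {z} → z ∈ outVars (a [ σ ]ᵃ) →
      ∃[ x ] (x ∈ outVars a × (z ≡ N + x))
    σ-outVars {a} d z∈ = ∈-map⁻ (N +_) (subst (_ ∈_) (varsᵛ-rename (outs a) (N +_) (σ-outs {a} d)) z∈)

    -- The atoms of `A` stay as they are, the outputs in `C` keep their variables and those of the
    -- body become fresh, so linearity persists. Inputs gain only input variables of `b`, which
    -- avoid all outputs to the right, and variables from `N` on, where a clash with an output of
    -- the body would already be one in the clause.
    resolvent-moded : ∀ {A C} → (∀ {x} → x ∈ varsᵠ (A ++ b ∷ C) → x < N) → SimplyModedClause c →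
      SimplyModed (A ++ b ∷ C) → SimplyModed (A [ ρ ]ᵠ ++ body c [ σ ]ᵠ ++ C [ ρ ]ᵠ)
    resolvent-moded {A} {C} bnd cm (good , pairs)
      with Allₚ.++⁻ A good | AllPairs-++⁻ A pairs
    ... | goodA , goodb ∷ goodC | pairsA , b⋈C ∷ pairsC , A⋈bC =
      subst (λ A′ → SimplyModed (A′ ++ B [ σ ]ᵠ ++ C [ ρ ]ᵠ)) (sym A-fixed)
        ( Allₚ.++⁺ goodA (Allₚ.++⁺ (Allₚ.map⁺ (All.zipWith (λ {a} → good-B {a}) (head-apart , proj₁ body-moded)))
                                   (Allₚ.map⁺ (All.zipWith (λ {a} → good-C {a}) (ok-C , goodC))))
        , AllPairsₚ.++⁺ pairsA
            (AllPairsₚ.++⁺ (AllPairsₚ.map⁺ (AllPairs-mapWith (λ {a e} → pair-BB {a} {e}) head-apart (proj₂ body-moded)))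
                           (AllPairsₚ.map⁺ (AllPairs-mapWith {P = Ok} (λ {a e} → pair-CC {a} {e}) ok-C pairsC))
                           (Allₚ.map⁺ (All.map (λ {a} → pair-BC-all {a}) head-apart)))
            (All.tabulate λ {a} a∈ → Allₚ.++⁺
               (Allₚ.map⁺ (All.map (λ {e} → pair-AB {a} (λ x∈ → bnd (∈-varsᵠ (∈-++⁺ˡ a∈) x∈)) {e}) head-apart))
               (Allₚ.map⁺ (All.zipWith (λ {e} → pair-AC {a} {e}) (ok-C , All.tail (All.lookup A⋈bC a∈))))))
      where
      open SimplyModedClause cm
      B = body c

      Ok : Atom → Set
      Ok a = b ⋈ a × (∀ {x} → x ∈ varsᵃ a → x < N)

      ok-C : All Ok C
      ok-C = All.tabulate λ a∈ → All.lookup b⋈C a∈ , λ x∈ → bnd (∈-varsᵠ (∈-++⁺ʳ A (there a∈)) x∈)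

      A-fixed : A [ ρ ]ᵠ ≡ A
      A-fixed = go (All.map All.head A⋈bC)
        where
        go : ∀ {A} → All (_⋈ b) A → A [ ρ ]ᵠ ≡ A
        go [] = refl
        go (p ∷ ps) = cong₂ _∷_ (ρ-apart p) (go ps)

      b<N : ∀ {x} → x ∈ inVars b → x < N
      b<N x∈ = bnd (∈-varsᵠ (∈-++⁺ʳ A (here refl)) (∈-++⁺ˡ x∈))

      shift≮ : ∀ {x} {Z : Set} → N + x < N → Z
      shift≮ lt = ⊥-elim (ℕₚ.m+n≮m N _ lt)

      in-out-B : ∀ a e → Disjoint (inVars h) (outVars e) → Disjoint (inVars a) (outVars e) →
        Disjoint (inVars (a [ σ ]ᵃ)) (outVars (e [ σ ]ᵃ))
      in-out-B a e d ae (z∈a , z∈e) with varsᵛ-[]⁻ (ins a) z∈a | σ-outVars {e} d z∈e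
      ... | x , x∈a , z∈σ | y , y∈e , refl with σ-vars z∈σ
      ... | inj₁ z∈b = shift≮ (b<N z∈b)
      ... | inj₂ eq with ℕₚ.+-cancelˡ-≡ N _ _ eq
      ... | refl = ae (x∈a , y∈e)

      in-out-C : ∀ a e → Ok e → Disjoint (inVars a) (outVars e) →
        Disjoint (inVars (a [ ρ ]ᵃ)) (outVars (e [ ρ ]ᵃ))
      in-out-C a e (b⋈e , e<N) ae (z∈a , z∈e) with varsᵛ-[]⁻ (ins a) z∈a | subst (λ v → _ ∈ varsᵛ v) (ρ-outs {e} b⋈e) z∈e
      ... | x , x∈a , z∈ρ | z∈e′ with ρ-vars z∈ρ
      ... | inj₁ refl = ae (x∈a , z∈e′)
      ... | inj₂ (inj₁ z∈b) = proj₂ b⋈e (z∈b , z∈e′)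
      ... | inj₂ (inj₂ N≤z) = ℕₚ.<⇒≱ (e<N (∈-++⁺ʳ (inVars e) z∈e′)) N≤z

      good-B : ∀ {a} → Disjoint (inVars h) (outVars a) × ModedAtom a → ModedAtom (a [ σ ]ᵃ)
      good-B {a} (d , vs , u , io) =
        VecAllₚ.lookup⁻ (λ i → subst IsVar (sym (lookup-[] (outs a) i)) (is-var i)) ,
        subst Unique (sym (varsᵛ-rename (outs a) (N +_) (σ-outs {a} d))) (Uniqueₚ.map⁺ (ℕₚ.+-cancelˡ-≡ N _ _) u) ,
        in-out-B a a d io
        where
        renamed : ∀ {n} {ts : Vec Term n} i → IsVar (Vec.lookup ts i) → (∀ x → x ∈ varsᵛ ts → σ x ≡ var (N + x)) →
          IsVar (Vec.lookup ts i [ σ ])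
        renamed {ts = var x ∷ ts} zero (isVar x) eq = subst IsVar (sym (eq x (here refl))) (isVar _)
        renamed {ts = t ∷ ts} (suc i) v eq = renamed {ts = ts} i v (λ x → eq x ∘ ∈-++⁺ʳ (vars t))

        is-var : ∀ i → IsVar (Vec.lookup (outs a) i [ σ ])
        is-var i = renamed {ts = outs a} i (VecAllₚ.lookup⁺ vs i) (σ-outs {a} d)

      good-C : ∀ {a} → Ok a × ModedAtom a → ModedAtom (a [ ρ ]ᵃ)
      good-C {a} (ok , vs , u , io) =
        subst (VecAll.All IsVar) (sym (ρ-outs {a} (proj₁ ok))) vs ,
        subst (Unique ∘ varsᵛ) (sym (ρ-outs {a} (proj₁ ok))) u ,
        in-out-C a a ok io

      pair-BB : ∀ {a e} → Disjoint (inVars h) (outVars a) → Disjoint (inVars h) (outVars e) → a ⋈ e →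
        a [ σ ]ᵃ ⋈ e [ σ ]ᵃ
      pair-BB {a} {e} da de (oo , io) = outs-apart , in-out-B a e de io
        where
        outs-apart : Disjoint (outVars (a [ σ ]ᵃ)) (outVars (e [ σ ]ᵃ))
        outs-apart (z∈a , z∈e) with σ-outVars {a} da z∈a | σ-outVars {e} de z∈e
        ... | x , x∈ , refl | y , y∈ , eq with ℕₚ.+-cancelˡ-≡ N _ _ eq
        ... | refl = oo (x∈ , y∈)

      pair-CC : ∀ {a e} → Ok a → Ok e → a ⋈ e → a [ ρ ]ᵃ ⋈ e [ ρ ]ᵃ
      pair-CC {a} {e} ok-a ok-e (oo , io) =
        (λ (z∈a , z∈e) → oo (subst (λ v → _ ∈ varsᵛ v) (ρ-outs {a} (proj₁ ok-a)) z∈a ,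
                             subst (λ v → _ ∈ varsᵛ v) (ρ-outs {e} (proj₁ ok-e)) z∈e)) ,
        in-out-C a e ok-e io

      pair-BC : ∀ {a} → Disjoint (inVars h) (outVars a) → ∀ {e} → Ok e → a [ σ ]ᵃ ⋈ e [ ρ ]ᵃ
      pair-BC {a} d {e} (b⋈e , e<N) = outs-apart , ins-apart
        where
        out-e : ∀ {z} → z ∈ outVars (e [ ρ ]ᵃ) → z ∈ outVars e
        out-e = subst (λ v → _ ∈ varsᵛ v) (ρ-outs {e} b⋈e)

        outs-apart : Disjoint (outVars (a [ σ ]ᵃ)) (outVars (e [ ρ ]ᵃ))
        outs-apart (z∈a , z∈e) with σ-outVars {a} d z∈a
        ... | x , _ , refl = shift≮ (e<N (∈-++⁺ʳ (inVars e) (out-e z∈e)))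

        ins-apart : Disjoint (inVars (a [ σ ]ᵃ)) (outVars (e [ ρ ]ᵃ))
        ins-apart (z∈a , z∈e) with varsᵛ-[]⁻ (ins a) z∈a
        ... | x , _ , z∈σ with σ-vars z∈σ
        ... | inj₁ z∈b = proj₂ b⋈e (z∈b , out-e z∈e)
        ... | inj₂ refl = shift≮ (e<N (∈-++⁺ʳ (inVars e) (out-e z∈e)))

      pair-BC-all : ∀ {a} → Disjoint (inVars h) (outVars a) → All (a [ σ ]ᵃ ⋈_) (C [ ρ ]ᵠ)
      pair-BC-all {a} d = Allₚ.map⁺ (All.map (λ {e} → pair-BC {a} d {e}) ok-C)

      pair-AB : ∀ {a} → (∀ {x} → x ∈ varsᵃ a → x < N) → ∀ {e} → Disjoint (inVars h) (outVars e) → a ⋈ e [ σ ]ᵃ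
      pair-AB {a} a<N {e} d = (λ (z∈a , z∈e) → fresh (∈-++⁺ʳ (inVars a) z∈a) z∈e) , λ (z∈a , z∈e) → fresh (∈-++⁺ˡ z∈a) z∈e
        where
        fresh : ∀ {z} → z ∈ varsᵃ a → z ∈ outVars (e [ σ ]ᵃ) → ⊥
        fresh z∈a z∈e with σ-outVars {e} d z∈e
        ... | _ , _ , refl = shift≮ (a<N z∈a)

      pair-AC : ∀ {a e} → Ok e × a ⋈ e → a ⋈ e [ ρ ]ᵃ
      pair-AC {a} {e} ((b⋈e , _) , a⋈e) =
        subst (λ v → Disjoint (outVars a) (varsᵛ v) × Disjoint (inVars a) (varsᵛ v)) (sym (ρ-outs {e} b⋈e)) a⋈e

fresh : List ℕ → ℕ
fresh xs = suc (max 0 xs)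

<fresh : ∀ {xs x} → x ∈ xs → x < fresh xs
<fresh {xs} x∈ = s≤s (All.lookup (xs≤max 0 xs) x∈)

-- Runs and the reordering of resolution steps

module Runs (S : Signature) (cs : List (LogicPrograms.Clause S))
  (moded : ∀ {c} → c ∈ cs → Substitution.SimplyModedClause S c) where

  open LogicPrograms S
  open Substitution S

  -- Quantifying over all unifiers makes Run stable under instantiation.
  data Run : ℕ → Query → Set where
    done    : Run 0 []
    skip    : ∀ {n a C} → Run n C → Run n (a ∷ C)
    resolve : ∀ {n a C} c → c ∈ cs → Matches (head c) a →
      (∀ σ ρ → head c [ σ ]ᵃ ≡ a [ ρ ]ᵃ → SimplyModed (body c [ σ ]ᵠ ++ C [ ρ ]ᵠ) →
         Run n (body c [ σ ]ᵠ ++ C [ ρ ]ᵠ)) →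
      Run (suc n) (a ∷ C)

  Run-zero : ∀ Q → Run 0 Q
  Run-zero [] = done
  Run-zero (a ∷ Q) = skip (Run-zero Q)

  Run-skips : ∀ {n} A {C} → Run n C → Run n (A ++ C)
  Run-skips [] r = r
  Run-skips (a ∷ A) r = skip (Run-skips A r)

  -- The last resolution of the run is given up, and everything from there on is skipped.
  Run-pred : ∀ {n Q} → Run (suc n) Q → Run n Q
  Run-pred (skip r) = skip (Run-pred r)
  Run-pred {zero} (resolve _ _ _ _) = Run-zero _
  Run-pred {suc n} (resolve c c∈ m f) = resolve c c∈ m (λ σ ρ eq sm → Run-pred (f σ ρ eq sm))

  Run-antitone : ∀ {m n Q} → m ≤ n → Run n Q → Run m Q
  Run-antitone {m} {n} m≤n r with ℕₚ.m≤n⇒m<n∨m≡n m≤n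
  ... | inj₂ refl = r
  Run-antitone {m} {suc n} m≤n r | inj₁ (s≤s m≤n′) = Run-antitone m≤n′ (Run-pred r)

  Run-[] : ∀ {n Q} τ → Run n Q → Run n (Q [ τ ]ᵠ)
  Run-[] τ done = done
  Run-[] τ (skip r) = skip (Run-[] τ r)
  Run-[] τ (resolve {n} {a} {C} c c∈ m f) = resolve c c∈ (Matches-[] a m) λ σ ρ eq sm →
    subst (λ C′ → Run n (body c [ σ ]ᵠ ++ C′)) (sym ([]ᵠ-⨟ C))
      (f σ (τ ⨟ ρ) (trans eq ([]ᵃ-⨟ a)) (subst (λ C′ → SimplyModed (body c [ σ ]ᵠ ++ C′)) ([]ᵠ-⨟ C) sm))

  SimplyModed-middle : ∀ A {b C} → SimplyModed (A ++ b ∷ C) → ModedAtom b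
  SimplyModed-middle A (good , _) = All.head (Allₚ.++⁻ʳ A good)

  -- The step at `b` is postponed past the steps of the run at atoms of `A`: nothing happens at a
  -- skipped atom, and at a resolved one the two steps are exchanged. The recursion is on the length
  -- of the run first, because an exchange puts a clause body in front of `b`.
  resolve-inner : ∀ n A {b C c} N (r : Resolver N b (head c)) →
    (∀ {x} → x ∈ varsᵠ (A ++ b ∷ C) → x < N) → SimplyModed (A ++ b ∷ C) →
    c ∈ cs → Matches (head c) b →
    Run n (A [ Resolver.ρ r ]ᵠ ++ body c [ Resolver.σ r ]ᵠ ++ C [ Resolver.ρ r ]ᵠ) → Run (suc n) (A ++ b ∷ C)
  -- Every unifier factors through the resolver, so the run required is an instance of the given
  -- one.
  resolve-inner n [] {b} {C} {c} N r bnd sm c∈ m run = resolve c c∈ m λ σ′ ρ′ eq sm′ →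
    let τ , ρτ , στ = Resolution.factor {c = c} r (bnd ∘ ∈-++⁺ˡ) eq
    in subst (Run n) (trans ([]ᵠ-++ (body c [ σ ]ᵠ))
         (cong₂ _++_ (trans ([]ᵠ-⨟ (body c)) ([]ᵠ-cong (body c) (λ x _ → στ x)))
                     (trans ([]ᵠ-⨟ C) ([]ᵠ-cong C (λ x x∈ → ρτ (bnd (∈-++⁺ʳ (varsᵃ b) x∈)))))))
         (Run-[] τ run)
    where open Resolver r
  resolve-inner n (a ∷ A) N r bnd (_ ∷ good , _ ∷ pairs) c∈ m (skip run) =
    skip (resolve-inner n A N r (λ x∈ → bnd (∈-++⁺ʳ (varsᵃ a) x∈)) (good , pairs) c∈ m run)
  resolve-inner (suc n) (a ∷ A) {b} {C} {c} N r bnd (_ , a⋈ ∷ _) c∈ m (resolve d d∈ md f) =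
    -- The step at `b` leaves `a` as it is, so `d` matches `a` itself.
    resolve d d∈ (subst (Matches (head d)) (Resolution.ρ-apart {c = c} r {a} (All.head (Allₚ.++⁻ʳ A a⋈))) md) after-a
    where
    open Resolver r

    after-a : ∀ σ′ ρ′ → head d [ σ′ ]ᵃ ≡ a [ ρ′ ]ᵃ → SimplyModed (body d [ σ′ ]ᵠ ++ (A ++ b ∷ C) [ ρ′ ]ᵠ) →
      Run (suc n) (body d [ σ′ ]ᵠ ++ (A ++ b ∷ C) [ ρ′ ]ᵠ)
    after-a σ′ ρ′ eq sm = subst (Run (suc n)) (sym L-eq)
      (resolve-inner n A₁ N₁ r₁ <fresh sm₁ c∈ m₁
        (subst (Run n) R-eq (f (σ′ ⨟ ρ₁) τ eq₁ (subst SimplyModed (sym R-eq) sm₂))))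
      where
      A₁ = body d [ σ′ ]ᵠ ++ A [ ρ′ ]ᵠ
      b₁ = b [ ρ′ ]ᵃ
      C₁ = C [ ρ′ ]ᵠ
      N₁ = fresh (varsᵠ (A₁ ++ b₁ ∷ C₁))

      L-eq : body d [ σ′ ]ᵠ ++ (A ++ b ∷ C) [ ρ′ ]ᵠ ≡ A₁ ++ b₁ ∷ C₁
      L-eq = trans (cong (body d [ σ′ ]ᵠ ++_) ([]ᵠ-++ A)) (sym (++-assoc (body d [ σ′ ]ᵠ) _ _))

      sm₁ = subst SimplyModed L-eq sm
      m₁ = Matches-[] {head c} b {ρ′} m
      r₁ = resolver N₁ b₁ (head c) (SimplyModed-middle A₁ sm₁) m₁
      open Resolver r₁ using () renaming (ρ to ρ₁; σ to σ₁; unifies to unifies₁)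

      sm₂ = Resolution.resolvent-moded {c = c} r₁ {A₁} {C₁} <fresh (moded c∈) sm₁

      -- The unifier of `b` found after the step at `a` factors through the resolver `r` used before
      -- it. The factor `τ` is the step at `a` as it looks once `b` is resolved, and so both orders
      -- end in the same query (`R-eq`).
      factored = Resolution.factor {c = c} r
        (λ x∈ → bnd (∈-++⁺ʳ (varsᵃ a) (∈-varsᵠ {A ++ b ∷ C} (∈-++⁺ʳ A (here refl)) x∈)))
        {ρ′ ⨟ ρ₁} {σ₁} (trans unifies₁ ([]ᵃ-⨟ b))
      τ = proj₁ factored
      ρτ = proj₁ (proj₂ factored)
      στ = proj₂ (proj₂ factored)

      ρτᵃ : ∀ e → (∀ {x} → x ∈ varsᵃ e → x < N) → e [ ρ ]ᵃ [ τ ]ᵃ ≡ e [ ρ′ ]ᵃ [ ρ₁ ]ᵃ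
      ρτᵃ e e<N = trans ([]ᵃ-⨟ e) (trans ([]ᵃ-cong e (λ x x∈ → ρτ (e<N x∈))) (sym ([]ᵃ-⨟ e)))

      ρτᵠ : ∀ E → (∀ {x} → x ∈ varsᵠ E → x < N) → E [ ρ ]ᵠ [ τ ]ᵠ ≡ E [ ρ′ ]ᵠ [ ρ₁ ]ᵠ
      ρτᵠ E E<N = trans ([]ᵠ-⨟ E) (trans ([]ᵠ-cong E (λ x x∈ → ρτ (E<N x∈))) (sym ([]ᵠ-⨟ E)))

      eq₁ : head d [ σ′ ⨟ ρ₁ ]ᵃ ≡ a [ ρ ]ᵃ [ τ ]ᵃ
      eq₁ = trans (sym ([]ᵃ-⨟ (head d))) (trans (cong (_[ ρ₁ ]ᵃ) eq) (sym (ρτᵃ a (bnd ∘ ∈-++⁺ˡ))))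

      A<N : ∀ {x} → x ∈ varsᵠ A → x < N
      A<N x∈ = bnd (∈-++⁺ʳ (varsᵃ a) (varsᵠ-⊆ {A} {A ++ b ∷ C} ∈-++⁺ˡ x∈))

      C<N : ∀ {x} → x ∈ varsᵠ C → x < N
      C<N x∈ = bnd (∈-++⁺ʳ (varsᵃ a) (varsᵠ-⊆ {C} {A ++ b ∷ C} (λ e∈ → ∈-++⁺ʳ A (there e∈)) x∈))

      R-eq : body d [ σ′ ⨟ ρ₁ ]ᵠ ++ (A [ ρ ]ᵠ ++ body c [ σ ]ᵠ ++ C [ ρ ]ᵠ) [ τ ]ᵠ ≡
             A₁ [ ρ₁ ]ᵠ ++ body c [ σ₁ ]ᵠ ++ C₁ [ ρ₁ ]ᵠ
      R-eq = begin
        body d [ σ′ ⨟ ρ₁ ]ᵠ ++ (A [ ρ ]ᵠ ++ body c [ σ ]ᵠ ++ C [ ρ ]ᵠ) [ τ ]ᵠ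
          ≡⟨ cong₂ _++_ (sym ([]ᵠ-⨟ (body d)))
               (trans ([]ᵠ-++ (A [ ρ ]ᵠ)) (cong₂ _++_ (ρτᵠ A A<N)
               (trans ([]ᵠ-++ (body c [ σ ]ᵠ)) (cong₂ _++_
                 (trans ([]ᵠ-⨟ (body c)) ([]ᵠ-cong (body c) (λ x _ → στ x))) (ρτᵠ C C<N))))) ⟩
        body d [ σ′ ]ᵠ [ ρ₁ ]ᵠ ++ A [ ρ′ ]ᵠ [ ρ₁ ]ᵠ ++ body c [ σ₁ ]ᵠ ++ C₁ [ ρ₁ ]ᵠ
          ≡⟨ sym (++-assoc (body d [ σ′ ]ᵠ [ ρ₁ ]ᵠ) _ _) ⟩
        (body d [ σ′ ]ᵠ [ ρ₁ ]ᵠ ++ A [ ρ′ ]ᵠ [ ρ₁ ]ᵠ) ++ body c [ σ₁ ]ᵠ ++ C₁ [ ρ₁ ]ᵠ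
          ≡⟨ cong (_++ (body c [ σ₁ ]ᵠ ++ C₁ [ ρ₁ ]ᵠ)) (sym ([]ᵠ-++ (body d [ σ′ ]ᵠ))) ⟩
        A₁ [ ρ₁ ]ᵠ ++ body c [ σ₁ ]ᵠ ++ C₁ [ ρ₁ ]ᵠ ∎
        where open ≡-Reasoning

-- Well-typedness, permuted queries and corresponding clauses

module Typing (S : Signature) where

  open LogicPrograms S
  open Substitution S

  permute-↭ : ∀ Q π → permute Q π ↭ Q
  permute-↭ Q π = ↭-trans (tabulate-permute (lookup Q) π) (↭-reflexive (tabulate-lookup Q))

  -- Disjointness of outputs is symmetric and survives any reordering. The condition on inputs
  -- concerns pairs in the order of `π`, which is the list order after `permute`; its case of equal
  -- indices gives disjointness within an atom.
  permute-moded : ∀ Q π → NicelyModedQuery Q π → OutputsAreVariables Q π → SimplyModed (permute Q π)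
  permute-moded Q π (linear , apart) vs = good , AllPairs.zip (outs-apart , ins-apart)
    where
    linear-parts = concatMap-Unique⁻ outVars Q linear

    good : All ModedAtom (permute Q π)
    good = Allₚ.tabulate⁺ λ k → let i = π ⟨$⟩ˡ k in
      All.lookup vs (∈-lookup i) , All.lookup (proj₁ linear-parts) (∈-lookup i) , apart i i Finₚ.≤-refl

    outs-apart : AllPairs (λ a b → Disjoint (outVars a) (outVars b)) (permute Q π)
    outs-apart = ↭ₛ.AllPairs-resp-↭ (setoid Atom) {R = λ a b → Disjoint (outVars a) (outVars b)}
      (λ d (p , q) → d (q , p)) ((λ { refl d → d }) , (λ { refl d → d }))
      (↭⇒↭ₛ (↭-sym (permute-↭ Q π))) (proj₂ linear-parts)

    ins-apart : AllPairs (λ a b → Disjoint (inVars a) (outVars b)) (permute Q π)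
    ins-apart = AllPairsₚ.tabulate⁺-< λ {k} {l} k<l →
      apart (π ⟨$⟩ˡ k) (π ⟨$⟩ˡ l) (subst₂ Fin._≤_ (sym (inverseʳ π)) (sym (inverseʳ π)) (ℕₚ.<⇒≤ k<l))

  InputsOf OutputsOf : Subst → Atom → Set
  InputsOf  σ a = (ins  a [ σ ]ᵛ) ∶ᵛ inType  (pred a)
  OutputsOf σ a = (outs a [ σ ]ᵛ) ∶ᵛ outType (pred a)

  -- The premises of the implications are accumulated in `H`, so the tail is well typed in the same
  -- sense under a stronger `H`, which allows induction on the query.
  WellTyped : (Subst → Set) → Query → Set
  WellTyped H [] = ⊤
  WellTyped H (a ∷ Q) = (∀ σ → H σ → InputsOf σ a) × WellTyped (λ σ → H σ × OutputsOf σ a) Q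

  InputsOf-⨟⁺ : ∀ a {σ τ} → InputsOf τ (a [ σ ]ᵃ) → InputsOf (σ ⨟ τ) a
  InputsOf-⨟⁺ a = subst (_∶ᵛ inType (pred a)) ([]ᵛ-⨟ (ins a))

  InputsOf-⨟⁻ : ∀ a {σ τ} → InputsOf (σ ⨟ τ) a → InputsOf τ (a [ σ ]ᵃ)
  InputsOf-⨟⁻ a = subst (_∶ᵛ inType (pred a)) (sym ([]ᵛ-⨟ (ins a)))

  OutputsOf-⨟⁺ : ∀ a {σ τ} → OutputsOf τ (a [ σ ]ᵃ) → OutputsOf (σ ⨟ τ) a
  OutputsOf-⨟⁺ a = subst (_∶ᵛ outType (pred a)) ([]ᵛ-⨟ (outs a))

  OutputsOf-⨟⁻ : ∀ a {σ τ} → OutputsOf (σ ⨟ τ) a → OutputsOf τ (a [ σ ]ᵃ)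
  OutputsOf-⨟⁻ a = subst (_∶ᵛ outType (pred a)) (sym ([]ᵛ-⨟ (outs a)))

  WellTyped-weaken : ∀ Q {H H′ : Subst → Set} → (∀ σ → H′ σ → H σ) → WellTyped H Q → WellTyped H′ Q
  WellTyped-weaken [] f _ = tt
  WellTyped-weaken (a ∷ Q) f (wa , wQ) = (λ σ → wa σ ∘ f σ) , WellTyped-weaken Q (λ σ (h , o) → f σ h , o) wQ

  WellTyped-[] : ∀ Q {H H′ : Subst → Set} {ρ} → (∀ τ → H′ τ → H (ρ ⨟ τ)) → WellTyped H Q → WellTyped H′ (Q [ ρ ]ᵠ)
  WellTyped-[] [] f _ = tt
  WellTyped-[] (a ∷ Q) f (wa , wQ) =
    (λ τ h → InputsOf-⨟⁻ a (wa _ (f τ h))) , WellTyped-[] Q (λ τ (h , o) → f τ h , OutputsOf-⨟⁺ a o) wQ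

  WellTyped-++ : ∀ B {C} {H : Subst → Set} → WellTyped H B → WellTyped (λ σ → H σ × All (OutputsOf σ) B) C →
    WellTyped H (B ++ C)
  WellTyped-++ [] {C} _ wC = WellTyped-weaken C (λ σ h → h , []) wC
  WellTyped-++ (b ∷ B) {C} (wb , wB) wC =
    wb , WellTyped-++ B wB (WellTyped-weaken C (λ σ ((h , o) , os) → h , o ∷ os) wC)

  tabulate-WellTyped : ∀ {n} (g : Fin n → Atom) {H : Subst → Set} →
    (∀ i σ → H σ → (∀ j → j Fin.< i → OutputsOf σ (g j)) → InputsOf σ (g i)) → WellTyped H (tabulate g)
  tabulate-WellTyped {zero} g w = tt
  tabulate-WellTyped {suc n} g w =
    (λ σ h → w zero σ h λ _ ()) ,
    tabulate-WellTyped (g ∘ suc) λ i σ (h , o) os →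
      w (suc i) σ h λ { zero _ → o ; (suc j) (s≤s j<i) → os j j<i }

  permute-WellTyped : ∀ Q π {H : Subst → Set} →
    (∀ i σ → H σ → (∀ j → π ⟨$⟩ʳ j Fin.< π ⟨$⟩ʳ i → OutputsTyped Q π σ j) → InputsTyped Q π σ i) →
    WellTyped H (permute Q π)
  permute-WellTyped Q π w = tabulate-WellTyped _ λ k σ h os → w (π ⟨$⟩ˡ k) σ h λ j lt →
    subst (OutputsTyped Q π σ) (inverseˡ π) (os (π ⟨$⟩ʳ j) (subst (π ⟨$⟩ʳ j Fin.<_) (inverseʳ π) lt))

  -- The constant substitution with value `t` turns the variable into an arbitrary term `t` while
  -- the atom stays typed.
  variable-input⇒variable-type : ∀ a i → (∀ σ → InputsOf σ a) → IsVar (Vec.lookup (ins a) i) →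
    IsVariableType (inType (pred a) i)
  variable-input⇒variable-type a i typed v t =
    subst (_∶ inType (pred a) i) (trans (lookup-[] (ins a) i) (const-instance v)) (typed (λ _ → t) i)
    where
    const-instance : ∀ {u} → IsVar u → u [ (λ _ → t) ] ≡ t
    const-instance (isVar x) = refl

  simply-typed-atom : ∀ {a} → ModedAtom a → (∀ σ → InputsOf σ a) → SimplyTypedQuery (a ∷ [])
  simply-typed-atom {a} (vs , u , d) typed =
    (Uniqueₚ.++⁺ u [] (λ { (_ , ()) }) , λ { zero zero _ → d }) , (λ { zero σ _ → typed σ }) , vs ∷ []

  -- The clause `c` is viewed in the left-to-right order of its body, while `bound` and `predicates`
  -- still speak of `P`, for which selectability and non-speculativeness are stated.
  record ClauseOf (P : Program) (source c : Clause) : Set where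
    field
      same-head   : head c ≡ head source
      same-body   : body c ↭ body source
      moded       : SimplyModedClause c
      flat        : ∀ i → Flat (Vec.lookup (ins (head c)) i)
      var-typed   : ∀ i → IsVariableType (inType (pred (head c)) i) → IsVar (Vec.lookup (ins (head c)) i)
      bound       : ∀ i → ¬ IsVar (Vec.lookup (ins (head c)) i) → BoundInput P (pred (head c)) i
      body-typed  : WellTyped (λ σ → InputsOf σ (head c)) (body c)
      outs-typed  : ∀ σ → InputsOf σ (head c) → All (OutputsOf σ) (body c) → OutputsOf σ (head c)
      predicates  : All (PredicateOf P ∘ pred) (body c)

  corresponding⇒ClauseOf : ∀ {P c c′} → InputLinear P → c ∈ clauses P → CorrespondingClause c c′ → ClauseOf P c c′
  corresponding⇒ClauseOf {P} {c} (linear , _) c∈ (π , ((nice , head-disjoint) , (ins-typed , outs-typed) , vs , heads) , refl) =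
    record
    { same-head = refl ; same-body = perm
    ; moded = record
        { body-moded = permute-moded B π nice vs
        ; head-apart = Allₚ.tabulate⁺ λ k (p , q) → head-disjoint (p , ∈-outs (∈-lookup {xs = B} (π ⟨$⟩ˡ k)) q)
        ; input-linear = linear c c∈ }
    ; flat = λ i → proj₁ (heads i)
    ; var-typed = λ i → proj₂ (proj₂ (heads i))
    ; bound = λ i nv → _ , _ , _ , c∈ , nv
    ; body-typed = permute-WellTyped B π ins-typed
    ; outs-typed = λ σ i os → outs-typed σ i λ j → All.lookup os (↭.∈-resp-↭ (↭-sym perm) (∈-lookup {xs = B} j))
    ; predicates = All.tabulate λ b∈ → c , c∈ , there (∈-map⁺ pred (↭.∈-resp-↭ perm b∈))
    }
    where
    B = body c
    perm = permute-↭ B π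

    ∈-outs : ∀ {Q a x} → a ∈ Q → x ∈ outVars a → x ∈ concatMap outVars Q
    ∈-outs (here refl) x∈ = ∈-++⁺ˡ x∈
    ∈-outs {b ∷ Q} (there a∈) x∈ = ∈-++⁺ʳ (outVars b) (∈-outs a∈ x∈)

-- A classical pigeonhole argument

¬∀⇒∃¬ : ExcludedMiddle 0ℓ → {R : ℕ → Set} → ¬ (∀ k → R k) → ∃[ k ] ¬ R k
¬∀⇒∃¬ em {R} ¬all with em {∃[ k ] ¬ R k}
... | yes ex = ex
... | no ¬ex = contradiction (λ k → case em {R k} of λ { (yes r) → r ; (no ¬r) → contradiction (k , ¬r) ¬ex }) ¬all

-- If `x` fails at some `K`, by antitonicity it fails from `K` on, so asking at `k ⊔ K` yields a
-- witness in the tail of the list.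
pigeonhole : ExcludedMiddle 0ℓ → {A : Set} {R : A → ℕ → Set} → (∀ {x m n} → m ≤ n → R x n → R x m) →
  ∀ xs → (∀ k → ∃[ x ] (x ∈ xs × R x k)) → ∃[ x ] (x ∈ xs × (∀ k → R x k))
pigeonhole em anti [] f = case f 0 of λ { (_ , () , _) }
pigeonhole em {R = R} anti (x ∷ xs) f with em {∀ k → R x k}
... | yes all = x , here refl , all
... | no ¬all =
  let K , ¬R = ¬∀⇒∃¬ em ¬all
      y , y∈ , all = pigeonhole em anti xs λ k → case f (k ⊔ K) of λ where
        (_ , here refl , r) → contradiction (anti (ℕₚ.m≤n⊔m k K) r) ¬R
        (y , there y∈ , r) → y , y∈ , anti (ℕₚ.m≤m⊔n k K) r
  in y , there y∈ , all

-- Runs of every length from the given derivation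

module Simulation (em : ExcludedMiddle 0ℓ) (S : Signature) (P P′ : LogicPrograms.Program S)
  (nonspec : LogicPrograms.NonSpeculative S P) (selectability : LogicPrograms.InputSelectability S P)
  (corr : LogicPrograms.CorrespondingProgram S P P′) where

  open LogicPrograms S
  open Substitution S
  open Typing S

  clause-of : ∀ {c} → c ∈ clauses P′ → ∃[ source ] ClauseOf P source c
  clause-of c∈ = let source , s∈ , r = Pointwise-∈ʳ (proj₁ corr) c∈ in
    source , corresponding⇒ClauseOf {P} (proj₁ (proj₂ nonspec)) s∈ r

  clause-moded : ∀ {c} → c ∈ clauses P′ → SimplyModedClause c
  clause-moded c∈ = ClauseOf.moded (proj₂ (clause-of c∈))

  open Runs S (clauses P′) clause-moded

  Predicates : Query → Set
  Predicates = All (PredicateOf P ∘ pred)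

  module _ {Q : Query} (D : InfiniteDerivation P Q) (sel : ∀ n → Selectable P (selected (step D n))) where

    -- The mgus of the given derivation are arbitrary and may rename variables, so that its queries are
    -- only variants of those obtained with canonical resolvers.
    derivation⇒Run : ∀ k n L τ τ⁻ → L [ τ ]ᵠ ↭ query D n → L [ τ ]ᵠ [ τ⁻ ]ᵠ ≡ L →
      SimplyModed L → Predicates L → Run k L
    derivation⇒Run zero n L _ _ _ _ _ _ = Run-zero L
    derivation⇒Run (suc k) n L τ τ⁻ perm inv sm preds
      with ∈-map⁻ (_[ τ ]ᵃ) (↭.∈-resp-↭ (↭-sym perm)
             (subst (selected (step D n) ∈_) (sym (split (step D n))) (∈-insert (before (step D n)))))
    ... | b , b∈ , sel-b with ∈-∃++ b∈
    ... | A , C , refl =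
      -- `b` is the atom that `τ` sends to the selected one. Its step is sorted into the run
      -- obtained from the rest of the derivation.
      resolve-inner k A N r <fresh sm c∈ matches
        (derivation⇒Run k (suc n) L′ τ′ τ′⁻ perm′ inv′
          (Resolution.resolvent-moded {c = c} r {A} {C} <fresh (ClauseOf.moded cof) sm) preds′)
      where
      st = step D n
      d = input st

      c′ = Pointwise-∈ˡ (proj₁ corr) (clause∈P st)
      c = proj₁ c′
      c∈ = proj₁ (proj₂ c′)
      cof = corresponding⇒ClauseOf {P} (proj₁ (proj₂ nonspec)) (clause∈P st) (proj₂ (proj₂ c′))
      B = body c

      μ = proj₁ (variant st)
      μ-eq = proj₁ (proj₂ (variant st))
      μ⁻ = proj₁ (proj₂ (proj₂ (variant st)))
      μ⁻-eq = proj₂ (proj₂ (proj₂ (variant st)))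

      head-d : head d ≡ head c [ μ ]ᵃ
      head-d = trans (cong head (sym μ-eq)) (cong (_[ μ ]ᵃ) (sym (ClauseOf.same-head cof)))

      B-perm : B [ μ ]ᵠ ↭ body d
      B-perm = ↭-trans (↭.map⁺ (_[ μ ]ᵃ) (ClauseOf.same-body cof)) (↭-reflexive (cong body μ-eq))

      unified : head c [ μ ⨟ θ st ]ᵃ ≡ b [ τ ⨟ θ st ]ᵃ
      unified = begin
        head c [ μ ⨟ θ st ]ᵃ      ≡⟨ sym ([]ᵃ-⨟ (head c)) ⟩
        head c [ μ ]ᵃ [ θ st ]ᵃ   ≡⟨ cong (_[ θ st ]ᵃ) (sym head-d) ⟩
        head d [ θ st ]ᵃ          ≡⟨ sym (proj₁ (mgu st)) ⟩
        selected st [ θ st ]ᵃ     ≡⟨ cong (_[ θ st ]ᵃ) sel-b ⟩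
        b [ τ ]ᵃ [ θ st ]ᵃ        ≡⟨ []ᵃ-⨟ b ⟩
        b [ τ ⨟ θ st ]ᵃ           ∎
        where open ≡-Reasoning

      τ-invertible : ∀ {x} → x ∈ varsᵠ (A ++ b ∷ C) → τ x [ τ⁻ ] ≡ var x
      τ-invertible = []ᵠ-cong⁻ (A ++ b ∷ C) {τ ⨟ τ⁻} {var}
        (trans (sym ([]ᵠ-⨟ (A ++ b ∷ C))) (trans inv (sym ([]ᵠ-var (A ++ b ∷ C)))))

      b-vars : ∀ {x} → x ∈ varsᵃ b → x ∈ varsᵠ (A ++ b ∷ C)
      b-vars = ∈-varsᵠ b∈

      b-inv : b [ τ ]ᵃ [ τ⁻ ]ᵃ ≡ b
      b-inv = trans ([]ᵃ-⨟ b) (trans ([]ᵃ-cong b (λ x x∈ → τ-invertible (b-vars x∈))) ([]ᵃ-var b))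

      -- A compound term could not be turned back into a variable by `τ⁻`.
      IsVar-τ : ∀ {m} {ts : Vec Term m} i → ts [ τ ]ᵛ [ τ⁻ ]ᵛ ≡ ts → IsVar (Vec.lookup ts i) →
        IsVar (Vec.lookup (ts [ τ ]ᵛ) i)
      IsVar-τ {ts = ts} i eq v = IsVar-[]⁻ _ (subst IsVar
        (trans (cong (λ v → Vec.lookup v i) (sym eq)) (lookup-[] (ts [ τ ]ᵛ) i)) v)

      good-b = SimplyModed-middle A sm

      -- The first half of input selectability, applied to the selected atom and carried back to `b`
      -- along the renaming `τ`.
      bound-inputs : ∀ i → BoundInput P (pred b) i → ¬ IsVar (Vec.lookup (ins b) i)
      bound-inputs i bi v =
        proj₁ (proj₂ selectability (b [ τ ]ᵃ) (All.lookup preds b∈)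
                 (λ j _ → IsVar-τ {ts = outs b} j (proj₂ (atom-injective b-inv)) (VecAllₚ.lookup⁺ (proj₁ good-b) j)))
          (subst (Selectable P) sel-b (sel n)) i bi (IsVar-τ {ts = ins b} i (proj₁ (atom-injective b-inv)) v)

      matches : Matches (head c) b
      matches = unifiable⇒Matches (BoundInput P) (head c) b (ClauseOf.flat cof)
        (SimplyModedClause.input-linear (ClauseOf.moded cof)) unified (ClauseOf.bound cof) bound-inputs

      N = fresh (varsᵠ (A ++ b ∷ C))
      r = resolver N b (head c) good-b matches
      open Resolver r

      L′ = A [ ρ ]ᵠ ++ B [ σ ]ᵠ ++ C [ ρ ]ᵠ

      preds′ : Predicates L′
      preds′ = Allₚ.++⁺ (Allₚ.map⁺ (Allₚ.++⁻ˡ A preds))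
        (Allₚ.++⁺ (Allₚ.map⁺ (ClauseOf.predicates cof)) (Allₚ.map⁺ (All.tail (Allₚ.++⁻ʳ A preds))))

      -- The unifier of the given step factors through the canonical one, and the factor is the next
      -- renaming.
      factored = Resolution.factor {c = c} r (<fresh ∘ b-vars) unified
      τ′ = proj₁ factored

      ρτ′ : ∀ E → (∀ {a} → a ∈ E → a ∈ A ++ b ∷ C) → E [ ρ ]ᵠ [ τ′ ]ᵠ ≡ E [ τ ]ᵠ [ θ st ]ᵠ
      ρτ′ E E⊆ = trans ([]ᵠ-⨟ E) (trans ([]ᵠ-cong E (λ x x∈ →
        proj₁ (proj₂ factored) (<fresh (varsᵠ-⊆ {E} {A ++ b ∷ C} E⊆ x∈)))) (sym ([]ᵠ-⨟ E)))

      στ′ : B [ σ ]ᵠ [ τ′ ]ᵠ ≡ B [ μ ]ᵠ [ θ st ]ᵠ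
      στ′ = trans ([]ᵠ-⨟ B) (trans ([]ᵠ-cong B (λ x _ → proj₂ (proj₂ factored) x)) (sym ([]ᵠ-⨟ B)))

      A⊆ : ∀ {a} → a ∈ A → a ∈ A ++ b ∷ C
      A⊆ = ∈-++⁺ˡ

      C⊆ : ∀ {a} → a ∈ C → a ∈ A ++ b ∷ C
      C⊆ a∈ = ∈-++⁺ʳ A (there a∈)

      []ᵠ-++₃ : ∀ X Y {Z υ} → (X ++ Y ++ Z) [ υ ]ᵠ ≡ X [ υ ]ᵠ ++ Y [ υ ]ᵠ ++ Z [ υ ]ᵠ
      []ᵠ-++₃ X Y = trans ([]ᵠ-++ X) (cong (X [ _ ]ᵠ ++_) ([]ᵠ-++ Y))

      L′τ′ : L′ [ τ′ ]ᵠ ≡ (A [ τ ]ᵠ ++ B [ μ ]ᵠ ++ C [ τ ]ᵠ) [ θ st ]ᵠ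
      L′τ′ = trans ([]ᵠ-++₃ (A [ ρ ]ᵠ) (B [ σ ]ᵠ))
        (trans (cong₂ _++_ (ρτ′ A A⊆) (cong₂ _++_ στ′ (ρτ′ C C⊆))) (sym ([]ᵠ-++₃ (A [ τ ]ᵠ) (B [ μ ]ᵠ))))

      rest-perm : A [ τ ]ᵠ ++ C [ τ ]ᵠ ↭ before st ++ after st
      rest-perm = ↭.drop-mid (A [ τ ]ᵠ) (before st)
        (↭-trans (↭-reflexive (sym ([]ᵠ-++ A))) (↭-trans perm
          (↭-reflexive (trans (split st) (cong (λ a → before st ++ a ∷ after st) sel-b)))))

      perm′ : L′ [ τ′ ]ᵠ ↭ query D (suc n)
      perm′ = ↭-trans (↭-reflexive L′τ′) (↭-trans (↭.map⁺ (_[ θ st ]ᵃ)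
        (↭-trans (↭.shifts (A [ τ ]ᵠ) (B [ μ ]ᵠ))
          (↭-trans (↭.++⁺ B-perm rest-perm) (↭.shifts (body d) (before st)))))
        (↭-reflexive (sym (result st))))

      -- The canonical unifier, transported to the variables of the given derivation.
      ψ : Subst
      ψ x with x ∈? varsᵠ (query D n)
      ... | yes _ = (τ⁻ ⨟ ρ) x
      ... | no  _ = (μ⁻ ⨟ σ) x

      ψ-query : ∀ {x} → x ∈ varsᵠ (query D n) → ψ x ≡ (τ⁻ ⨟ ρ) x
      ψ-query {x} x∈ with x ∈? varsᵠ (query D n)
      ... | yes _ = refl
      ... | no x∉ = contradiction x∈ x∉

      ψ-clause : ∀ {x} → x ∈ varsᶜ d → ψ x ≡ (μ⁻ ⨟ σ) x
      ψ-clause {x} x∈ with x ∈? varsᵠ (query D n)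
      ... | yes x∈Q = ⊥-elim (apart st (x∈ , x∈Q))
      ... | no _    = refl

      query-vars : ∀ {a z} → a ∈ A ++ b ∷ C → z ∈ varsᵃ (a [ τ ]ᵃ) → z ∈ varsᵠ (query D n)
      query-vars a∈ = ∈-varsᵠ (↭.∈-resp-↭ perm (∈-map⁺ (_[ τ ]ᵃ) a∈))

      ψ-unifies : Unifier ψ (selected st) (head d)
      ψ-unifies = begin
        selected st [ ψ ]ᵃ             ≡⟨ cong (_[ ψ ]ᵃ) sel-b ⟩
        b [ τ ]ᵃ [ ψ ]ᵃ                ≡⟨ []ᵃ-cong (b [ τ ]ᵃ) (λ x x∈ → ψ-query (query-vars b∈ x∈)) ⟩
        b [ τ ]ᵃ [ τ⁻ ⨟ ρ ]ᵃ           ≡⟨ sym ([]ᵃ-⨟ (b [ τ ]ᵃ)) ⟩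
        b [ τ ]ᵃ [ τ⁻ ]ᵃ [ ρ ]ᵃ        ≡⟨ cong (_[ ρ ]ᵃ) b-inv ⟩
        b [ ρ ]ᵃ                       ≡⟨ sym unifies ⟩
        head c [ σ ]ᵃ                  ≡⟨ cong (_[ σ ]ᵃ) (trans (ClauseOf.same-head cof) (cong head (sym μ⁻-eq))) ⟩
        head d [ μ⁻ ]ᵃ [ σ ]ᵃ          ≡⟨ []ᵃ-⨟ (head d) ⟩
        head d [ μ⁻ ⨟ σ ]ᵃ             ≡⟨ []ᵃ-cong (head d) (λ x x∈ → sym (ψ-clause (∈-++⁺ˡ x∈))) ⟩
        head d [ ψ ]ᵃ                  ∎
        where open ≡-Reasoning

      -- As the given mgu is most general, `ψ` factors through it. This factor undoes `τ′` on `L′`.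
      τ′⁻ = proj₁ (proj₂ (mgu st) ψ ψ-unifies)
      θτ′⁻ : ∀ x → ψ x ≡ θ st x [ τ′⁻ ]
      θτ′⁻ = proj₂ (proj₂ (mgu st) ψ ψ-unifies)

      E-back : ∀ E → (∀ {a} → a ∈ E → a ∈ A ++ b ∷ C) → E [ τ ]ᵠ [ ψ ]ᵠ ≡ E [ ρ ]ᵠ
      E-back E E⊆ = begin
        E [ τ ]ᵠ [ ψ ]ᵠ           ≡⟨ []ᵠ-cong (E [ τ ]ᵠ) (λ x x∈ → ψ-query (E-vars x∈)) ⟩
        E [ τ ]ᵠ [ τ⁻ ⨟ ρ ]ᵠ      ≡⟨ sym ([]ᵠ-⨟ (E [ τ ]ᵠ)) ⟩
        E [ τ ]ᵠ [ τ⁻ ]ᵠ [ ρ ]ᵠ   ≡⟨ cong (_[ ρ ]ᵠ) (trans ([]ᵠ-⨟ E) (trans ([]ᵠ-cong E (λ x x∈ →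
                                       τ-invertible (varsᵠ-⊆ {E} {A ++ b ∷ C} E⊆ x∈))) ([]ᵠ-var E))) ⟩
        E [ ρ ]ᵠ                  ∎
        where
        open ≡-Reasoning
        E-vars : ∀ {z} → z ∈ varsᵠ (E [ τ ]ᵠ) → z ∈ varsᵠ (query D n)
        E-vars z∈ with varsᵠ⁻ (E [ τ ]ᵠ) z∈
        ... | _ , a∈ , z∈a with ∈-map⁻ (_[ τ ]ᵃ) a∈
        ... | a , a∈E , refl = query-vars (E⊆ a∈E) z∈a

      B-back : B [ μ ]ᵠ [ ψ ]ᵠ ≡ B [ σ ]ᵠ
      B-back = begin
        B [ μ ]ᵠ [ ψ ]ᵠ           ≡⟨ []ᵠ-cong (B [ μ ]ᵠ) (λ x x∈ → ψ-clause (∈-++⁺ʳ (varsᵃ (head d))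
                                       (varsᵠ-⊆ {B [ μ ]ᵠ} {body d} (↭.∈-resp-↭ B-perm) x∈))) ⟩
        B [ μ ]ᵠ [ μ⁻ ⨟ σ ]ᵠ      ≡⟨ sym ([]ᵠ-⨟ (B [ μ ]ᵠ)) ⟩
        B [ μ ]ᵠ [ μ⁻ ]ᵠ [ σ ]ᵠ   ≡⟨ cong (_[ σ ]ᵠ) (trans ([]ᵠ-⨟ B) (trans ([]ᵠ-cong B (λ x x∈ →
                                       μ-invertible (varsᵠ-⊆ {B} {body (clause st)} (↭.∈-resp-↭ (ClauseOf.same-body cof)) x∈)))
                                       ([]ᵠ-var B))) ⟩
        B [ σ ]ᵠ                  ∎
        where
        open ≡-Reasoning
        B₀ = body (clause st)
        μ-invertible : ∀ {x} → x ∈ varsᵠ B₀ → μ x [ μ⁻ ] ≡ var x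
        μ-invertible = []ᵠ-cong⁻ B₀ {μ ⨟ μ⁻} {var}
          (trans (sym ([]ᵠ-⨟ B₀)) (trans (trans (cong (λ e → body e [ μ⁻ ]ᵠ) μ-eq) (cong body μ⁻-eq)) (sym ([]ᵠ-var B₀))))

      inv′ : L′ [ τ′ ]ᵠ [ τ′⁻ ]ᵠ ≡ L′
      inv′ = begin
        L′ [ τ′ ]ᵠ [ τ′⁻ ]ᵠ                   ≡⟨ cong (_[ τ′⁻ ]ᵠ) L′τ′ ⟩
        M [ θ st ]ᵠ [ τ′⁻ ]ᵠ                  ≡⟨ []ᵠ-⨟ M ⟩
        M [ θ st ⨟ τ′⁻ ]ᵠ                     ≡⟨ []ᵠ-cong M (λ x _ → sym (θτ′⁻ x)) ⟩
        M [ ψ ]ᵠ                              ≡⟨ []ᵠ-++₃ (A [ τ ]ᵠ) (B [ μ ]ᵠ) ⟩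
        A [ τ ]ᵠ [ ψ ]ᵠ ++ B [ μ ]ᵠ [ ψ ]ᵠ ++ C [ τ ]ᵠ [ ψ ]ᵠ
          ≡⟨ cong₂ _++_ (E-back A A⊆) (cong₂ _++_ B-back (E-back C C⊆)) ⟩
        L′ ∎
        where
        open ≡-Reasoning
        M = A [ τ ]ᵠ ++ B [ μ ]ᵠ ++ C [ τ ]ᵠ

  -- From runs of every length to an LD-derivation

  Continues : Atom → Query → Clause → ℕ → Set
  Continues a C c k = Matches (head c) a ×
    (∀ σ ρ → head c [ σ ]ᵃ ≡ a [ ρ ]ᵃ → SimplyModed (body c [ σ ]ᵠ ++ C [ ρ ]ᵠ) →
       Run k (body c [ σ ]ᵠ ++ C [ ρ ]ᵠ))

  Continues-antitone : ∀ {a C c m n} → m ≤ n → Continues a C c n → Continues a C c m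
  Continues-antitone m≤n (mt , f) = mt , λ σ ρ eq sm → Run-antitone m≤n (f σ ρ eq sm)

  -- An LD-derivation commits to a clause, so a single clause has to serve all lengths `k`. The
  -- cases differ in whether the rest of the query alone has runs of every length.
  choose-clause : ∀ {a C} → ModedAtom a → (∀ σ → InputsOf σ a) → PredicateOf P (pred a) → (∀ k → Run k (a ∷ C)) →
    ∃[ c ] (c ∈ clauses P′ × (∀ k → Continues a C c k))
  choose-clause {a} {C} good typed predicate runs with em {∀ k → Run k C}
  -- The atom is irrelevant for the long runs: resolve it by whatever clause is applicable.
  ... | yes runsC =
    let c , d , c∈ , (μ , μ-eq , _) , _ , θ , unifies =
          proj₂ (proj₂ nonspec) a predicate (simply-typed-atom good typed)
        c′ , c′∈ , corr-c = Pointwise-∈ˡ (proj₁ corr) c∈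
        cof = corresponding⇒ClauseOf {P} (proj₁ (proj₂ nonspec)) c∈ corr-c
        -- In positions of variable type the head has a variable, and in all others a well-typed
        -- atom has none, so no compound head argument meets a variable.
        matches = unifiable⇒Matches (λ p i → ¬ IsVariableType (inType p i)) (head c′) a {μ ⨟ θ} {θ}
          (ClauseOf.flat cof) (SimplyModedClause.input-linear (ClauseOf.moded cof))
          (trans (sym ([]ᵃ-⨟ (head c′))) (trans (cong (λ h → h [ μ ]ᵃ [ θ ]ᵃ) (ClauseOf.same-head cof))
            (trans (cong (λ e → head e [ θ ]ᵃ) μ-eq) (sym unifies))))
          (λ i nv vt → nv (ClauseOf.var-typed cof i vt))
          (λ i nvt v → nvt (variable-input⇒variable-type a i typed v))
    in c′ , c′∈ , λ k → matches , λ σ ρ _ _ → Run-skips (body c′ [ σ ]ᵠ) (Run-[] ρ (runsC k))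
  ... | no ¬runsC = pigeonhole em (λ {c} → Continues-antitone {a} {C} {c}) (clauses P′) resolved
    where
    K = proj₁ (¬∀⇒∃¬ em ¬runsC)

    resolved : ∀ k → ∃[ c ] (c ∈ clauses P′ × Continues a C c k)
    -- `C` has no run of length `K` or more, so a run this long cannot skip `a`. The successor pays
    -- for resolving `a`.
    resolved k with runs (suc (k ⊔ K))
    ... | skip r = contradiction (Run-antitone (ℕₚ.≤-trans (ℕₚ.m≤n⊔m k K) (ℕₚ.n≤1+n _)) r) (proj₂ (¬∀⇒∃¬ em ¬runsC))
    ... | resolve c c∈ mt f = c , c∈ , Continues-antitone {a} {C} {c} (ℕₚ.m≤m⊔n k K) (mt , f)

  -- The invariant of the LD-derivation. `limit` exceeds every variable used so far, so
  -- standardisation apart becomes a comparison of numbers.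
  record State : Set where
    field
      current : Query
      limit   : ℕ
      vars<   : ∀ {x} → x ∈ varsᵠ current → x < limit
      moded   : SimplyModed current
      typed   : WellTyped (λ _ → ⊤) current
      preds   : Predicates current
      runs    : ∀ k → Run k current

  open State

  record LDStep (s s′ : State) : Set where
    field
      ld-step : Step P′ (current s) (current s′)
      leftmost : before ld-step ≡ []
      limit≤   : limit s ≤ limit s′
      new      : ∀ {x} → x ∈ varsᶜ (input ld-step) → limit s ≤ x
      used     : ∀ {x} → x ∈ varsᶜ (input ld-step) → x < limit s′

  open LDStep

  ld-next : ∀ s → ∃[ s′ ] LDStep s s′
  -- The empty query has no run of length 1, so the LD-derivation cannot stop here.
  ld-next record { current = [] ; runs = runs } = case runs 1 of λ ()
  ld-next record { current = a ∷ C ; limit = N ; vars< = bnd ; moded = sm ; typed = wa , wC ; preds = pa ∷ pC ; runs = runs } =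
    record
      { current = L′ ; limit = N′ ; moded = sm′ ; preds = Allₚ.++⁺ (Allₚ.map⁺ (ClauseOf.predicates cof)) (Allₚ.map⁺ pC)
      ; vars< = λ x∈ → ℕₚ.<-≤-trans (<fresh (∈-++⁺ˡ x∈)) (ℕₚ.m≤n⊔m N _)
      ; typed = typed′
      ; runs = λ k → proj₂ (continues k) σ ρ unifies sm′ } ,
    record
      { ld-step = record
          { before = [] ; selected = a ; after = C ; split = refl ; clause = c ; clause∈P = c∈ ; input = d
          ; variant = shift N , refl , (λ z → var (z ∸ N)) , unshift
          ; apart = λ (x∈d , x∈L) → ℕₚ.<⇒≱ (bnd x∈L) (d≥N x∈d)
          ; θ = ϑ
          -- `ϑ` followed by a unifier `ψ` is `ψ` again, so `ψ` itself is the factor.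
          ; mgu = ϑ-unifies , λ ψ eq → ψ , λ x → sym (ϑ-general ψ eq x)
          ; result = sym (trans ([]ᵠ-++ (body d)) (cong₂ _++_ (trans ([]ᵠ-⨟ B) ([]ᵠ-cong B λ x _ → shifted N x))
                                                   ([]ᵠ-cong C λ x x∈ → below (bnd (∈-++⁺ʳ (varsᵃ a) x∈))))) }
      ; leftmost = refl
      ; limit≤ = ℕₚ.m≤m⊔n N _
      ; new = d≥N
      ; used = λ x∈ → ℕₚ.<-≤-trans (<fresh (∈-++⁺ʳ (varsᵠ L′) x∈)) (ℕₚ.m≤n⊔m N _) }
    where
    good-a = All.head (proj₁ sm)
    chosen = choose-clause good-a (λ σ → wa σ tt) pa runs
    c = proj₁ chosen
    c∈ = proj₁ (proj₂ chosen)
    continues = proj₂ (proj₂ chosen)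
    cof = proj₂ (clause-of c∈)
    h = head c
    B = body c
    d = c [ shift N ]ᶜ
    r = resolver N a h good-a (proj₁ (continues 0))
    open Resolver r

    L′ = B [ σ ]ᵠ ++ C [ ρ ]ᵠ
    -- Besides `L′` the new limit covers the variables of `d` that do not survive in `L′`; the join
    -- with `N` makes the limits monotone.
    N′ = N ⊔ fresh (varsᵠ L′ ++ varsᶜ d)
    sm′ = Resolution.resolvent-moded {c = c} r {[]} {C} bnd (ClauseOf.moded cof) sm
    ϑ = below-or-shifted N ρ σ

    d≥N : ∀ {x} → x ∈ varsᶜ d → N ≤ x
    d≥N x∈ with ∈-++⁻ (varsᵃ (head d)) x∈
    ... | inj₁ x∈h with varsᵃ-[]⁻ h x∈h
    ...   | y , _ , here refl = ℕₚ.m≤m+n N y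
    d≥N x∈ | inj₂ x∈B with varsᵠ-[]⁻ B x∈B
    ...   | y , _ , here refl = ℕₚ.m≤m+n N y

    unshift : d [ (λ z → var (z ∸ N)) ]ᶜ ≡ c
    unshift = cong₂ _⟵_
      (trans ([]ᵃ-⨟ h) (trans ([]ᵃ-cong h (λ x _ → cong var (ℕₚ.m+n∸m≡n N x))) ([]ᵃ-var h)))
      (trans ([]ᵠ-⨟ B) (trans ([]ᵠ-cong B (λ x _ → cong var (ℕₚ.m+n∸m≡n N x))) ([]ᵠ-var B)))

    ϑ-unifies : Unifier ϑ a (head d)
    ϑ-unifies = trans ([]ᵃ-cong a (λ x x∈ → below (bnd (∈-++⁺ˡ x∈)))) (trans (sym unifies)
      (trans ([]ᵃ-cong h (λ x _ → sym (shifted N x))) (sym ([]ᵃ-⨟ h))))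

    ϑ-general : ∀ ψ → Unifier ψ a (head d) → ∀ x → ϑ x [ ψ ] ≡ ψ x
    ϑ-general ψ eq x with x <? N
    ... | yes _ = proj₁ (general ψ eq) x
    ... | no x≮N = trans (proj₂ (general ψ eq) (x ∸ N)) (cong ψ (ℕₚ.m+[n∸m]≡n (ℕₚ.≮⇒≥ x≮N)))

    ins-h : ∀ τ → InputsOf (σ ⨟ τ) h
    ins-h τ = InputsOf-⨟⁺ h (subst (InputsOf τ) (sym unifies) (InputsOf-⨟⁻ a (wa (ρ ⨟ τ) tt)))

    outs-all : ∀ Q {τ} → All (OutputsOf τ) (Q [ σ ]ᵠ) → All (OutputsOf (σ ⨟ τ)) Q
    outs-all [] _ = []
    outs-all (e ∷ Q) (o ∷ os) = OutputsOf-⨟⁺ e o ∷ outs-all Q os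

    -- Subject reduction: the typed inputs of `a` are those of the head and make the body well
    -- typed. Typed body outputs then give typed head outputs, which are the outputs of `a` and thus
    -- the premise for `C`.
    typed′ : WellTyped (λ _ → ⊤) L′
    typed′ = WellTyped-++ (B [ σ ]ᵠ) (WellTyped-[] B (λ τ _ → ins-h τ) (ClauseOf.body-typed cof))
      (WellTyped-[] C (λ τ (_ , os) → tt , OutputsOf-⨟⁺ a (subst (OutputsOf τ) unifies
        (OutputsOf-⨟⁻ h (ClauseOf.outs-typed cof (σ ⨟ τ) (ins-h τ) (outs-all B os))))) wC)

  ld-derivation : (s : State) → InfiniteLDDerivation P′ (current s)
  ld-derivation s₀ =
    record
      { query = λ n → current (state n)
      ; start = refl
      ; step = λ n → ld-step (next n)
      ; apart-queries = λ m n m<n (x∈d , x∈Q) →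
          ℕₚ.<⇒≱ (vars< (state m) x∈Q) (ℕₚ.≤-trans (limit-mono (ℕₚ.<⇒≤ m<n)) (new (next n) x∈d))
      ; apart-clauses = λ m n m<n (x∈n , x∈m) →
          ℕₚ.<⇒≱ (used (next m) x∈m) (ℕₚ.≤-trans (limit-mono m<n) (new (next n) x∈n)) } ,
    λ n → leftmost (next n)
    where
    state : ℕ → State
    state zero = s₀
    state (suc n) = proj₁ (ld-next (state n))

    next : ∀ n → LDStep (state n) (state (suc n))
    next n = proj₂ (ld-next (state n))

    limit-mono : ∀ {m n} → m ≤ n → limit (state m) ≤ limit (state n)
    limit-mono {m} {n} m≤n with ℕₚ.m≤n⇒m<n∨m≡n m≤n
    ... | inj₂ refl = ℕₚ.≤-refl
    limit-mono {m} {suc n} m≤n | inj₁ (s≤s m≤n′) = ℕₚ.≤-trans (limit-mono m≤n′) (limit≤ (next n))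

theorem4p8 : ExcludedMiddle 0ℓ →
    (S : Signature) (let open LogicPrograms S) →
    (P P′ : Program) → NonSpeculative P → InputSelectability P → CorrespondingProgram P P′ →
    (Q Q′ : Query) → PermutationSimplyTypedQuery Q → All (PredicateOf P) (map pred Q) → CorrespondingQuery Q Q′ →
    InfiniteDelayRespectingDerivation P Q →
    InfiniteLDDerivation P′ Q′
theorem4p8 em S P P′ nonspec selectability corr Q _ _ preds (π , (nice , typed , vs) , refl) (D , sel) =
  ld-derivation record
    { current = Q′ ; limit = fresh (varsᵠ Q′) ; vars< = <fresh ; moded = moded ; preds = preds′
    ; typed = permute-WellTyped Q π (λ i σ _ → typed i σ)
    -- `Q′` is a reordering of the first query, so the identity serves as the renaming and as its
    -- inverse.
    ; runs = λ k → derivation⇒Run D sel k 0 Q′ var var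
        (↭-trans (↭-reflexive ([]ᵠ-var Q′)) (↭-trans perm (↭-reflexive (sym (start D)))))
        (trans ([]ᵠ-var (Q′ [ var ]ᵠ)) ([]ᵠ-var Q′)) moded preds′ }
  where
  open LogicPrograms S
  open Substitution S
  open Typing S
  open Simulation em S P P′ nonspec selectability corr
  Q′ = permute Q π
  perm = permute-↭ Q π
  moded = permute-moded Q π nice vs
  preds′ = ↭.All-resp-↭ (↭-sym perm) (Allₚ.map⁻ preds)
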